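{- Let $G$ be a graph with no odd hole. Then $\chi(G)\le 2^{2^{\omega(G)+2}}$.
   Context: All graphs are finite and have no loops or parallel edges. A hole in a graph is an induced subgraph which is a cycle of length at least four; a hole is odd if its length (number of edges) is odd (so an odd hole is an induced cycle of odd length at least five). $\chi(G)$ denotes the chromatic number of $G$, and $\omega(G)$ denotes the cardinality of the largest clique of $G$, where a clique is a set of pairwise adjacent vertices. -}

module Defs where

open import Data.Fin.Base using (Fin; toℕ; finToFun; funToFin)
open import Data.Fin.Properties using (all?; any?; finToFun-funToFin) renaming (_≟_ to _≟ᶠ_)
open import Data.Fin.Subset using (Subset; _∈_; ∣_∣) renaming (⊥ to ∅)
open import Data.Fin.Subset.Properties using (_∈?_; ∉⊥; ∣⊥∣≡0; ∣p∣≤n; anySubset?)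
open import Data.Nat.Base using (ℕ; zero; suc; _≤_; z≤n; s≤s; s≤s⁻¹)
open import Data.Nat.Divisibility using (_∤_)
open import Data.Nat.Properties using (_≟_; ≤-trans; n≤1+n; 1+n≢n; m≤n⇒m<n∨m≡n)
open import Data.Product.Base using (Σ-syntax; ∃; ∃-syntax; _×_; _,_; proj₁; proj₂)
open import Data.Sum.Base using (_⊎_; inj₁; inj₂; swap)
open import Function.Base using (_∘_; id)
open import Function.Bundles using (_⇔_)
open import Function.Definitions using (Injective)
open import Level using (0ℓ)
open import Relation.Binary.Core using (Rel)
open import Relation.Binary.Definitions using (Symmetric; Irreflexive) renaming (Decidable to Decidable₂)
open import Relation.Binary.PropositionalEquality using (_≡_; _≢_; refl; sym; subst; subst₂)
open import Relation.Nullary using (¬_; yes; no; contradiction; ¬?)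
open import Relation.Nullary.Decidable using (map′; _×-dec_; _⊎-dec_; _→-dec_)
open import Relation.Unary using (Pred; Decidable)

record Graph (n : ℕ) : Set₁ where
  field
    Adj      : Rel (Fin n) 0ℓ
    adj?     : Decidable₂ Adj
    symAdj   : Symmetric Adj
    loopless : Irreflexive _≡_ Adj

open Graph public

-- Cyclic successor on 0, …, k - 1.
Next : ∀ {k} → Rel (Fin k) 0ℓ
Next {k} i j = toℕ j ≡ suc (toℕ i) ⊎ (suc (toℕ i) ≡ k × toℕ j ≡ 0)

next? : ∀ {k} → Decidable₂ (Next {k})
next? {k} i j = (toℕ j ≟ suc (toℕ i)) ⊎-dec ((suc (toℕ i) ≟ k) ×-dec (toℕ j ≟ 0))

¬next-refl : ∀ {k} → 3 ≤ k → (i : Fin k) → ¬ Next i i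
¬next-refl _ i (inj₁ e) = 1+n≢n (sym e)
¬next-refl {k} k≥3 i (inj₂ (e , z)) = absurd (subst (λ m → suc m ≡ k) z e) k≥3
  where
  absurd : ∀ {m} → 1 ≡ m → ¬ 3 ≤ m
  absurd refl (s≤s ())

cycle : ∀ {k} → 3 ≤ k → Graph k
cycle k≥3 = record
  { Adj      = λ i j → Next i j ⊎ Next j i
  ; adj?     = λ i j → next? i j ⊎-dec next? j i
  ; symAdj   = swap
  ; loopless = λ { {i} refl (inj₁ p) → ¬next-refl k≥3 i p
                 ; {i} refl (inj₂ p) → ¬next-refl k≥3 i p }
  }

-- An isomorphism from H onto an induced subgraph of G.
record InducedCopy {m n} (H : Graph m) (G : Graph n) : Set where
  field
    embed     : Fin m → Fin n
    injective : Injective _≡_ _≡_ embed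
    induced   : ∀ i j → Adj H i j ⇔ Adj G (embed i) (embed j)

record Hole {n} (G : Graph n) : Set where
  field
    length   : ℕ
    length≥4 : 4 ≤ length
    copy     : InducedCopy (cycle (≤-trans (n≤1+n 3) length≥4)) G

OddHole : ∀ {n} → Graph n → Set
OddHole G = Σ[ h ∈ Hole G ] 2 ∤ Hole.length h

IsColouring : ∀ {n} (G : Graph n) (k : ℕ) → (Fin n → Fin k) → Set
IsColouring G k c = ∀ u v → Adj G u v → c u ≢ c v

Colourable : ∀ {n} → Graph n → ℕ → Set
Colourable G k = ∃[ c ] IsColouring G k c

IsChromaticNumber : ∀ {n} → Graph n → ℕ → Set
IsChromaticNumber G k = Colourable G k × (∀ m → Colourable G m → k ≤ m)

IsClique : ∀ {n} → Graph n → Subset n → Set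
IsClique G S = ∀ u v → u ∈ S → v ∈ S → u ≢ v → Adj G u v

HasClique : ∀ {n} → Graph n → ℕ → Set
HasClique G w = ∃[ S ] (IsClique G S × ∣ S ∣ ≡ w)

IsCliqueNumber : ∀ {n} → Graph n → ℕ → Set
IsCliqueNumber G w = HasClique G w × (∀ m → HasClique G m → m ≤ w)

least : ∀ {P : Pred ℕ 0ℓ} → Decidable P → ∀ n → P n → ∃[ k ] (P k × (∀ m → P m → k ≤ m))
least P? zero    p = zero , p , λ _ _ → z≤n
least {P} P? (suc n) p with P? zero
... | yes p₀ = zero , p₀ , λ _ _ → z≤n
... | no ¬p₀ with least (P? ∘ suc) n p
...   | k , q , min = suc k , q , bound
  where
  bound : ∀ m → P m → suc k ≤ m
  bound zero    r = contradiction r ¬p₀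
  bound (suc m) r = s≤s (min m r)

greatest : ∀ {P : Pred ℕ 0ℓ} → Decidable P → P 0 → ∀ n → (∀ m → P m → m ≤ n) →
           ∃[ k ] (P k × (∀ m → P m → m ≤ k))
greatest P? p₀ zero    b = zero , p₀ , b
greatest {P} P? p₀ (suc n) b with P? (suc n)
... | yes p = suc n , p , b
... | no ¬p = greatest P? p₀ n bound
  where
  bound : ∀ m → P m → m ≤ n
  bound m q with m≤n⇒m<n∨m≡n (b m q)
  ... | inj₁ m<1+n = s≤s⁻¹ m<1+n
  ... | inj₂ refl  = contradiction q ¬p

isColouring? : ∀ {n} (G : Graph n) k → Decidable (IsColouring G k)
isColouring? G k c = all? λ u → all? λ v → adj? G u v →-dec ¬? (c u ≟ᶠ c v)

-- finToFun enumerates the functions Fin n → Fin k (up to pointwise equality) by Fin (k ^ n).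
colourable? : ∀ {n} (G : Graph n) → Decidable (Colourable G)
colourable? {n} G k = map′ to from (any? λ i → isColouring? G k (finToFun i))
  where
  to : ∃ (IsColouring G k ∘ finToFun) → Colourable G k
  to (i , p) = finToFun i , p

  from : Colourable G k → ∃ (IsColouring G k ∘ finToFun)
  from (c , p) = funToFin c , λ u v a →
    subst₂ _≢_ (sym (finToFun-funToFin c u)) (sym (finToFun-funToFin c v)) (p u v a)

isClique? : ∀ {n} (G : Graph n) → Decidable (IsClique G)
isClique? G S = all? λ u → all? λ v →
  (u ∈? S) →-dec ((v ∈? S) →-dec (¬? (u ≟ᶠ v) →-dec adj? G u v))

hasClique? : ∀ {n} (G : Graph n) → Decidable (HasClique G)
hasClique? G w = anySubset? λ S → isClique? G S ×-dec (∣ S ∣ ≟ w)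

chromaticNumber : ∀ {n} (G : Graph n) → ∃ (IsChromaticNumber G)
chromaticNumber {n} G = least (colourable? G) n (id , λ { u .u a refl → loopless G refl a })

cliqueNumber : ∀ {n} (G : Graph n) → ∃ (IsCliqueNumber G)
cliqueNumber {n} G = greatest (hasClique? G)
  (∅ , (λ u v u∈∅ → contradiction u∈∅ ∉⊥) , ∣⊥∣≡0 n)
  n (λ { _ (S , _ , refl) → ∣p∣≤n S })

χ : ∀ {n} → Graph n → ℕ
χ G = proj₁ (chromaticNumber G)

χ-isChromaticNumber : ∀ {n} (G : Graph n) → IsChromaticNumber G (χ G)
χ-isChromaticNumber G = proj₂ (chromaticNumber G)

ω : ∀ {n} → Graph n → ℕ
ω G = proj₁ (cliqueNumber G)

ω-isCliqueNumber : ∀ {n} (G : Graph n) → IsCliqueNumber G (ω G)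
ω-isCliqueNumber G = proj₂ (cliqueNumber G)

{-# OPTIONS --safe #-}
module Submission where

-- Induct on the clique number ω: if N colours suffice for clique number ω - 1, then O(8^ω N²) colours suffice
-- for ω. Two vertices joined by induced paths on both sides of a separation are joined by paths of one parity
-- only, since otherwise there is an odd hole. Take a breadth-first level, a component C of it, and cover C from
-- below by minimal sets of ancestors; this yields a path (the spine) each of whose vertices is the only parent
-- of the next one. Up to a bounded factor, all vertices of C have ancestors seeing the spine in the same way, and
-- then comparing parities along the spine shows that adjacent vertices of one level have the same parents. So the
-- relation "adjacent, or joined from above by an odd induced path" on a level is P₄-free. If the level is moreover
-- stable, order it and send each vertex of the next level to its first parent: the edges between vertices with
-- odd-related parents form a graph coloured with 2^(ω-1) colours, and in each colour class the last parent of a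
-- clique is complete to it, so N colours suffice there. Applying this to the last two levels of ancestors and then
-- to C gives the recursion.

open import Defs
open import Data.Bool.Base using (Bool; true; false; not; _xor_)
import Data.Bool.Properties as Bool
open import Data.Empty using (⊥; ⊥-elim)
open import Data.Fin.Base using (Fin; zero; suc; toℕ; combine; inject≤; splitAt; _↑ˡ_; _↑ʳ_)
open import Data.Fin.Properties using (any?; all?; toℕ-injective; pigeonhole; combine-injective; inject≤-injective;
  ↑ˡ-injective; ↑ʳ-injective; splitAt-↑ˡ; splitAt-↑ʳ) renaming (_≟_ to _≟ᶠ_)
open import Data.Fin.Subset using (Subset; _∈_; _∉_; ∣_∣; inside; outside; _∪_; ⁅_⁆) renaming (⊥ to ∅)
open import Data.Fin.Subset.Properties using (∉⊥; ∣⊥∣≡0; x∈p∪q⁻; x∈⁅y⁆⇒x≡y; ∪-identityˡ)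
open import Data.List.Base using (List; []; _∷_; _++_; [_]; _∷ʳ_; length; lookup; allFin)
open import Data.List.Membership.Propositional using () renaming (_∈_ to _∈ˡ_)
open import Data.List.Membership.Propositional.Properties using (∈-allFin; ∈-lookup)
open import Data.List.Relation.Unary.All as All using (All; []; _∷_)
open import Data.List.Relation.Unary.All.Properties using (++⁺)
open import Data.List.Relation.Unary.AllPairs as AllPairs using (AllPairs; []; _∷_)
open import Data.List.Relation.Unary.Any using (here; there)
open import Data.Nat.Base using (ℕ; zero; suc; _+_; _*_; _∸_; _^_; _≤_; _<_; z≤n; s≤s; s≤s⁻¹; >-nonZero)
open import Data.Nat.Divisibility using (_∣_; divides)
open import Data.Nat.Properties using (≤-refl; ≤-trans; ≤-antisym; ≤-pred; <⇒≤; <-irrefl; ≰⇒>; <-cmp; _≤?_; _≟_;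
  n≤1+n; n<1+n; m<n⇒m<1+n; m≤n⇒m≤1+n; m≤n⇒m<n∨m≡n; m≤m+n; m≤m*n; m≤n*m; m+[n∸m]≡n; m∸[m∸n]≡n; n∸n≡0;
  suc-injective; +-suc; +-identityʳ; +-monoˡ-≤; *-monoʳ-≤; *-mono-≤; m^n>0; ^-distribˡ-+-*; module ≤-Reasoning)
open import Data.Nat.Tactic.RingSolver using (solve-∀)
open import Data.Product.Base using (Σ-syntax; ∃; ∃-syntax; _×_; _,_; proj₁; proj₂)
open import Data.Sum.Base using (_⊎_; inj₁; inj₂)
open import Data.Unit.Base using (⊤; tt)
open import Data.Vec.Base using (_∷_; []; here; there)
open import Function.Base using (_∘_; id)
open import Function.Bundles using (mk⇔)
open import Relation.Binary.Construct.Closure.ReflexiveTransitive using (Star; ε; _◅_; _◅◅_; gmap)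
open import Relation.Binary.Definitions using (Tri; tri<; tri≈; tri>)
open import Relation.Binary.PropositionalEquality using (_≡_; _≢_; refl; sym; trans; cong; subst; subst₂)
open import Relation.Nullary using (¬_; Dec; yes; no; contradiction; ¬?)
open import Relation.Nullary.Decidable using (_×-dec_; _⊎-dec_; _→-dec_; decidable-stable)
open import Relation.Unary using (Decidable)

-- Induced paths and the parity of their lengths

-- Parities can be compared only where two vertices of a level are also joined by a walk below them
-- that touches nothing else of their level or of the levels above. Minimal covers provide it: every
-- kept vertex has a private child, seen by no other kept vertex of its level. The spine serves as
-- the common reference because induced paths from a level to it have predictable length: even when
-- its vertices can be seen only from the next level, odd when other vertices see two consecutive
-- spine vertices or none. An ancestor path can first see the spine in four ways (only the spine
-- vertex one level up, only the one of the same level, both at an even level, both at an odd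
-- level), whence a factor 4; shifting the spine by one step reduces the second way to the first.
-- Equality of parents is available only strictly above the last level of ancestors, so that level
-- must itself be covered from the one before it: the factor `2 ^ w * N` occurs twice, which is the
-- origin of N².

odd : ∀ {A : Set} → List A → Bool
odd []       = false
odd (_ ∷ xs) = not (odd xs)

odd-++ : ∀ {A : Set} (xs ys : List A) → odd (xs ++ ys) ≡ odd xs xor odd ys
odd-++ []       ys = refl
odd-++ (_ ∷ xs) ys = trans (cong not (odd-++ xs ys)) (Bool.not-distribˡ-xor (odd xs) (odd ys))

odd-∷ʳ : ∀ {A : Set} (xs : List A) {x} → odd (xs ∷ʳ x) ≡ not (odd xs)
odd-∷ʳ []       = refl
odd-∷ʳ (_ ∷ xs) = cong not (odd-∷ʳ xs)

module Paths {n} (G : Graph n) where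

  infix 4 _~_
  _~_ : Fin n → Fin n → Set
  _~_ = Adj G

  _~?_ : ∀ x y → Dec (x ~ y)
  _~?_ = adj? G

  ~-sym : ∀ {x y} → x ~ y → y ~ x
  ~-sym = symAdj G

  ~-irr : ∀ {x} → ¬ x ~ x
  ~-irr = loopless G refl

  ~⇒≢ : ∀ {x y} → x ~ y → x ≢ y
  ~⇒≢ e refl = ~-irr e

  Far : Fin n → Fin n → Set
  Far x y = ¬ x ~ y × x ≢ y

  Far-sym : ∀ {x y} → Far x y → Far y x
  Far-sym (a , b) = a ∘ ~-sym , b ∘ sym

  -- Induced paths from x to y; the list is the interior.
  Path : Fin n → List (Fin n) → Fin n → Set
  Path x []       y = x ~ y
  Path x (p ∷ ps) y = x ~ p × All (Far x) ps × Far x y × Path p ps y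

  -- The cycle x, y, `l`, z has `length l + 3` vertices, so it is odd exactly when `l` is even;
  -- `l ≢ []` excludes the triangle.
  OddHoleFree : Set
  OddHoleFree = ∀ {x y z} l → Path y l z → x ~ y → x ~ z → All (Far x) l → odd l ≡ false → l ≢ [] → ⊥

  snoc : ∀ {x y z} ps → Path x ps y → y ~ z → All (Far z) ps → Far z x → Path x (ps ∷ʳ y) z
  snoc []       e e′ _ f = e , [] , Far-sym f , e′
  snoc (p ∷ ps) (e , fs , g , π) e′ (h ∷ hs) f =
    e , ++⁺ fs (g ∷ []) , Far-sym f , snoc ps π e′ hs h

  -- Carrying every `All Q` from `ps` to `qs` stands in for saying that both lists have the same
  -- members.
  reverse : ∀ {x y} ps → Path x ps y →
            ∃[ qs ] (Path y qs x × odd qs ≡ odd ps × (∀ {Q : Fin n → Set} → All Q ps → All Q qs))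
  reverse []       e = [] , ~-sym e , refl , id
  reverse {x} (p ∷ ps) (e , fs , g , π) with reverse ps π
  ... | qs , ρ , o , tr =
    qs ∷ʳ p , snoc qs ρ (~-sym e) (tr fs) g , trans (odd-∷ʳ qs) (cong not o) ,
    λ { (q ∷ r) → ++⁺ (tr r) (q ∷ []) }

  unsnoc : ∀ {x y} p ps → Path x (p ∷ ps) y →
           ∃[ qs ] ∃[ d ] (Path x qs d × d ~ y × All (Far y) qs × odd qs ≡ odd ps
                           × (∀ {Q : Fin n → Set} → All Q (p ∷ ps) → Q d × All Q qs))
  unsnoc p [] (e , _ , _ , e′) = [] , p , e , e′ , [] , refl , λ { (q ∷ []) → q , [] }
  unsnoc p (p′ ∷ ps) (e , f ∷ fs , g , π) with unsnoc p′ ps π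
  ... | qs , d , ρ , e′ , hs , o , tr = p ∷ qs , d , (e , proj₂ (tr (f ∷ fs)) , proj₁ (tr (f ∷ fs)) , ρ) ,
    e′ , Far-sym (proj₁ (proj₂ (proj₂ π))) ∷ hs , cong not o , λ { (q ∷ r) → proj₁ (tr r) , q ∷ proj₂ (tr r) }

  join : ∀ {x y z} ps ds → Path x ps y → Path y ds z →
         All (λ u → All (Far u) ds × Far u z) (x ∷ ps) → Path x (ps ++ y ∷ ds) z
  join []       ds e π ((f , g) ∷ []) = e , f , g , π
  join (p ∷ ps) ds (e , fs , h , ρ) π ((f , g) ∷ r) =
    e , ++⁺ fs (h ∷ f) , g , join ps ds ρ π r

  -- The two paths close up to a hole with `length ps + length ds + 2` vertices.
  theta : OddHoleFree → ∀ {x y} ps ds → Path x ps y → Path y ds x → Far x y →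
          All (λ u → All (Far u) ds) ps → odd ps ≡ odd ds
  theta ohf []       ds π ρ (x≁y , _) _ = contradiction π x≁y
  theta ohf (p ∷ ps) [] π ρ (x≁y , _) _ = contradiction (~-sym ρ) x≁y
  theta ohf {x} {y} (p ∷ ps) (d₀ ∷ ds₀) (e , fs , g , π) ρ far cross
    with unsnoc d₀ ds₀ ρ
  -- The hole is presented at `x`, whose neighbours on it are `p` and the last interior vertex `d`
  -- of the second path.
  ... | ds , d , ρ′ , e′ , hs , o , tr with odd (ps ++ y ∷ ds) in eq
  ...   | false = ⊥-elim (ohf (ps ++ y ∷ ds)
            (join ps ds π ρ′ (All.map (λ c → proj₂ (tr c) , proj₁ (tr c)) cross))
            e (~-sym e′) (++⁺ fs (far ∷ hs)) eq (nonempty ps))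
    where
    nonempty : ∀ xs → xs ++ y ∷ ds ≢ []
    nonempty []       ()
    nonempty (_ ∷ _) ()
  ...   | true = cong not (agree (odd ps) (odd ds) o (trans (sym (odd-++ ps (y ∷ ds))) eq))
    where
    agree : ∀ a b {c} → b ≡ c → a xor not b ≡ true → a ≡ c
    agree true  true  refl _ = refl
    agree false false refl _ = refl

  Edge : (Fin n → Set) → Fin n → Fin n → Set
  Edge S u v = u ~ v × S v

  reverse-walk : ∀ {S : Fin n → Set} {a b} → S a → Star (Edge S) a b → Star (Edge S) b a
  reverse-walk s ε              = ε
  reverse-walk s ((e , s′) ◅ w) = reverse-walk s′ w ◅◅ ((~-sym e , s) ◅ ε)

  walk-map : ∀ {S T : Fin n → Set} {a b} → (∀ {u} → S u → T u) → Star (Edge S) a b → Star (Edge T) a b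
  walk-map f = gmap id (λ (e , s) → e , f s)

  first-exit : ∀ {P C D : Fin n → Set} → (∀ x → Dec (P x)) → (∀ {x y} → D x → x ~ y → C y → ¬ P y → D y) →
               (∀ {x} → D x → ¬ P x) → ∀ {a b} → D a → Star (Edge C) a b → P b →
               ∃[ v ] ∃[ d ] (D d × C v × P v × v ~ d)
  first-exit P? grow out d ε p = contradiction p (out d)
  first-exit P? grow out {a} d (_◅_ {j = u} (e , c) w) p with P? u
  ... | yes q = u , a , d , c , q , ~-sym e
  ... | no ¬q = first-exit P? grow out (grow d e c ¬q) w p

  -- A walk from x to y with interior in S, and at least one interior vertex.
  record Via (S : Fin n → Set) (x y : Fin n) : Set where
    constructor via
    field
      {first last} : Fin n
      start    : x ~ first
      start-in : S first
      walk     : Star (Edge S) first last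
      end      : last ~ y

  -- The tail is searched before `z`, so `x` is attached to the last vertex of the path that it
  -- sees, and everything earlier is cut off; this keeps the path induced.
  prepend : ∀ {S : Fin n → Set} {x z y} ps → Path z ps y → S z → All S ps →
            (All (Far x) (z ∷ ps) × Far x y) ⊎ (x ≡ y ⊎ ∃[ qs ] (Path x qs y × All S qs))
  prepend {x = x} {z} {y} [] e s [] with x ≟ᶠ y | x ~? y | x ~? z
  ... | yes x≡y | _      | _      = inj₂ (inj₁ x≡y)
  ... | no _    | yes xy | _      = inj₂ (inj₂ ([] , xy , []))
  ... | no x≢y  | no x≁y | yes xz = inj₂ (inj₂ ([ z ] , (xz , [] , (x≁y , x≢y) , e) , s ∷ []))
  ... | no x≢y  | no x≁y | no x≁z = inj₁ (((x≁z , λ { refl → x≁y e }) ∷ []) , x≁y , x≢y)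
  prepend {x = x} {z} {y} (p ∷ ps) π@(e , _ , _ , ρ) s (t ∷ ts) with prepend {x = x} ps ρ t ts
  ... | inj₂ done = inj₂ done
  ... | inj₁ (far@((x≁p , _) ∷ _) , fy) with x ~? z
  ...   | yes xz = inj₂ (inj₂ (z ∷ p ∷ ps , (xz , far , fy , π) , s ∷ t ∷ ts))
  ...   | no x≁z = inj₁ ((x≁z , λ { refl → x≁p e }) ∷ far , fy)

  shorten′ : ∀ {S : Fin n → Set} {x y a b} → x ~ a → S a → Star (Edge S) a b → b ~ y →
             x ≡ y ⊎ ∃[ qs ] (Path x qs y × All S qs)
  shorten′ e s ε e′ with prepend [] e′ s []
  ... | inj₂ r = r
  ... | inj₁ ((x≁a , _) ∷ _ , _) = contradiction e x≁a
  shorten′ e s ((e″ , s′) ◅ w) e′ with shorten′ e″ s′ w e′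
  ... | inj₁ refl = inj₂ ([] , e , [])
  ... | inj₂ (qs , ρ , q) with prepend qs ρ s q
  ...   | inj₂ r = r
  ...   | inj₁ ((x≁a , _) ∷ _ , _) = contradiction e x≁a

  shorten : ∀ {S : Fin n → Set} {x y} → Via S x y → x ≢ y → ∃[ qs ] (Path x qs y × All S qs)
  shorten (via e s w e′) x≢y with shorten′ e s w e′
  ... | inj₁ x≡y = contradiction x≡y x≢y
  ... | inj₂ r   = r

  -- The walk in `S` shortens to one induced path, and `theta` compares both `ps` and `qs` with it.
  same-parity : OddHoleFree → ∀ {S : Fin n → Set} {x y} → Far x y → Via S y x → ∀ ps qs →
                Path x ps y → Path x qs y → All (λ u → ∀ v → S v → Far u v) ps →
                All (λ u → ∀ v → S v → Far u v) qs → odd ps ≡ odd qs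
  same-parity ohf far w ps qs π ρ f g with shorten w (proj₂ far ∘ sym)
  ... | ds , δ , s = trans
    (theta ohf ps ds π δ far (All.map (λ h → All.map (λ {v} → h v) s) f))
    (sym (theta ohf qs ds ρ δ far (All.map (λ h → All.map (λ {v} → h v) s) g)))

-- Colourings and breadth-first search

leastFin : ∀ {n} {P : Fin n → Set} → Decidable P → ∃ P → ∃[ z ] (P z × (∀ y → P y → toℕ z ≤ toℕ y))
leastFin {P = P} P? (z₀ , p₀)
  with least (λ k → any? λ z → (toℕ z ≟ k) ×-dec P? z) (toℕ z₀) (z₀ , refl , p₀)
... | _ , (z , refl , p) , min = z , p , λ y q → min (toℕ y) (y , refl , q)

abstract
  find : ∀ {n} {P : Fin n → Set} → Decidable P → Fin n → Fin n
  find P? d with any? P?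
  ... | yes e = proj₁ (leastFin P? e)
  ... | no  _ = d

  find-least : ∀ {n} {P : Fin n → Set} (P? : Decidable P) d → ∃ P →
               P (find P? d) × (∀ y → P y → toℕ (find P? d) ≤ toℕ y)
  find-least P? d e with any? P?
  ... | yes e′ = proj₂ (leastFin P? e′)
  ... | no  ¬e = contradiction e ¬e

element : ∀ {N} → 0 < N → Fin N
element (s≤s _) = zero

module _ {n : ℕ} where

  Col : (Fin n → Fin n → Set) → (Fin n → Set) → ℕ → Set
  Col R X N = Σ[ c ∈ (Fin n → Fin N) ] (∀ {u v} → X u → X v → R u v → c u ≢ c v)

  CliqueBound : (Fin n → Fin n → Set) → (Fin n → Set) → ℕ → Set
  CliqueBound R X w = ∀ K → AllPairs R K → All X K → length K ≤ w

  col-⊆ : ∀ {R X Y N} → (∀ {x} → Y x → X x) → Col R X N → Col R Y N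
  col-⊆ f (c , p) = c , λ x y → p (f x) (f y)

  col-mono : ∀ {R X M N} → M ≤ N → Col R X M → Col R X N
  col-mono le (c , p) = (λ x → inject≤ (c x) le) , λ xu xv r e → p xu xv r (inject≤-injective le le _ _ e)

  edgeless : ∀ {R X N} → Fin N → (∀ {x y} → X x → X y → ¬ R x y) → Col R X N
  edgeless d ¬r = (λ _ → d) , λ x y r → contradiction r (¬r x y)

  col-product : ∀ {R X M N} (f : Fin n → Fin M) →
                (∀ i → Col (λ u v → R u v) (λ x → X x × f x ≡ i) N) → Col R X (M * N)
  col-product {R} {X} f h = (λ x → combine (f x) (proj₁ (h (f x)) x)) , proper
    where
    proper : ∀ {u v} → X u → X v → R u v → combine (f u) (proj₁ (h (f u)) u) ≢ combine (f v) (proj₁ (h (f v)) v)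
    proper {u} {v} xu xv r eq with combine-injective _ _ _ _ eq
    ... | e , e′ = proj₂ (h (f v)) (xu , e) (xv , refl) r
                     (trans (cong (λ i → proj₁ (h i) u) (sym e)) e′)

  col-∪ : ∀ {R X Y M N} → Decidable X → Col R X M → Col R Y N → Col R (λ x → X x ⊎ Y x) (M + N)
  col-∪ {R} {X} {Y} {M} {N} X? (c , p) (d , q) = e , proper
    where
    e : Fin n → Fin (M + N)
    e x with X? x
    ... | yes _ = c x ↑ˡ N
    ... | no  _ = M ↑ʳ d x

    disjoint : ∀ i j → i ↑ˡ N ≢ M ↑ʳ j
    disjoint i j eq with trans (sym (splitAt-↑ˡ M i N)) (trans (cong (splitAt M) eq) (splitAt-↑ʳ M N j))
    ... | ()

    proper : ∀ {u v} → X u ⊎ Y u → X v ⊎ Y v → R u v → e u ≢ e v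
    proper {u} {v} xu xv r with X? u | X? v
    ... | yes a | yes b = λ eq → p a b r (↑ˡ-injective N _ _ eq)
    ... | yes a | no  _ = disjoint _ _
    ... | no  _ | yes b = λ eq → disjoint _ _ (sym eq)
    ... | no ¬a | no ¬b = λ eq → q (right ¬a xu) (right ¬b xv) r (↑ʳ-injective M _ _ eq)
      where
      right : ∀ {x} → ¬ X x → X x ⊎ Y x → Y x
      right ¬x (inj₁ x) = contradiction x ¬x
      right _  (inj₂ y) = y

parity₂ : ℕ → Fin 2
parity₂ zero          = zero
parity₂ (suc zero)    = suc zero
parity₂ (suc (suc i)) = parity₂ i

parity₂-suc : ∀ i → parity₂ (suc i) ≢ parity₂ i
parity₂-suc zero    ()
parity₂-suc (suc i) e = parity₂-suc i (sym e)

module BFS {n : ℕ} (R : Fin n → Fin n → Set) (R? : ∀ x y → Dec (R x y)) (R-sym : ∀ {x y} → R x y → R y x)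
           (X : Fin n → Set) (X? : Decidable X) (z : Fin n) where

  Within : ℕ → Fin n → Set
  Within zero    x = x ≡ z
  Within (suc i) x = Within i x ⊎ (X x × ∃[ y ] (Within i y × R y x))

  within? : ∀ i → Decidable (Within i)
  within? zero    x = x ≟ᶠ z
  within? (suc i) x = within? i x ⊎-dec (X? x ×-dec any? λ y → within? i y ×-dec R? y x)

  within-⊆ : X z → ∀ i {x} → Within i x → X x
  within-⊆ xz zero    refl           = xz
  within-⊆ xz (suc i) (inj₁ w)       = within-⊆ xz i w
  within-⊆ xz (suc i) (inj₂ (x , _)) = x

  within-mono : ∀ {i j x} → i ≤ j → Within i x → Within j x
  within-mono {i} {zero}  z≤n w = w
  within-mono {i} {suc j} i≤j w with m≤n⇒m<n∨m≡n i≤j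
  ... | inj₁ i<1+j = inj₁ (within-mono (≤-pred i<1+j) w)
  ... | inj₂ refl  = w

  abstract
   -- If none of the first n + 1 balls were closed, each would gain a new vertex at the next step,
   -- and by pigeonhole two of these gains would coincide.
   stable : ∃[ i ] (∀ x → Within (suc i) x → Within i x)
   stable with any? {n = suc n} (λ i → all? λ x → within? (suc (toℕ i)) x →-dec within? (toℕ i) x)
   ... | yes (i , s) = toℕ i , s
   ... | no ¬s = ⊥-elim collision
     where
     new : (i : Fin (suc n)) → ∃[ x ] (Within (suc (toℕ i)) x × ¬ Within (toℕ i) x)
     new i with any? (λ x → within? (suc (toℕ i)) x ×-dec ¬? (within? (toℕ i) x))
     ... | yes e = e
     ... | no ¬e = contradiction (i , λ x w → decidable-stable (within? (toℕ i) x) λ ¬w → ¬e (x , w , ¬w)) ¬s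

     collision : ⊥
     collision with pigeonhole (n<1+n n) (proj₁ ∘ new)
     ... | i , j , i<j , e = proj₂ (proj₂ (new j))
       (within-mono i<j (subst (Within (suc (toℕ i))) e (proj₁ (proj₂ (new i)))))

  Comp : Fin n → Set
  Comp = Within (proj₁ stable)

  comp? : Decidable Comp
  comp? = within? (proj₁ stable)

  comp-root : Comp z
  comp-root = within-mono z≤n refl

  comp-⊆ : X z → ∀ {x} → Comp x → X x
  comp-⊆ xz = within-⊆ xz (proj₁ stable)

  comp-closed : ∀ {x y} → Comp x → R x y → X y → Comp y
  comp-closed {x} {y} cx r xy = proj₂ stable y (inj₂ (xy , x , cx , r))

  within⇒comp : ∀ i {x} → Within i x → Comp x
  within⇒comp zero    refl                     = comp-root
  within⇒comp (suc i) (inj₁ w)                 = within⇒comp i w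
  within⇒comp (suc i) (inj₂ (xx , y , w , r)) = comp-closed (within⇒comp i w) r xx

  reach : ∀ {x} → Comp x → Star (λ u v → R u v × Comp v) z x
  reach = go (proj₁ stable)
    where
    go : ∀ i {x} → Within i x → Star (λ u v → R u v × Comp v) z x
    go zero    refl     = ε
    go (suc i) (inj₁ w) = go i w
    go (suc i) w′@(inj₂ (_ , y , w , r)) = go i w ◅◅ ((r , within⇒comp (suc i) w′) ◅ ε)

  abstract
   dist : Fin n → ℕ
   dist x with comp? x
   ... | yes w = proj₁ (least (λ i → within? i x) _ w)
   ... | no  _ = 0

   within-dist : ∀ {x} → Comp x → Within (dist x) x
   within-dist {x} w with comp? x
   ... | yes w′ = proj₁ (proj₂ (least (λ i → within? i x) _ w′))
   ... | no ¬w  = contradiction w ¬w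

   dist-least : ∀ {x i} → Within i x → dist x ≤ i
   dist-least {x} {i} w with comp? x
   ... | yes w′ = proj₂ (proj₂ (least (λ i → within? i x) _ w′)) i w
   ... | no ¬w  = z≤n

  Level : ℕ → Fin n → Set
  Level i x = Comp x × dist x ≡ i

  level? : ∀ i → Decidable (Level i)
  level? i x = comp? x ×-dec (dist x ≟ i)

  root-or-member : ∀ i {x} → Within i x → x ≡ z ⊎ X x
  root-or-member zero    e              = inj₁ e
  root-or-member (suc i) (inj₁ w)       = root-or-member i w
  root-or-member (suc i) (inj₂ (x , _)) = inj₂ x

  level-≤ : ∀ {i j x y} → Level i x → Level j y → R x y → j ≤ suc i
  level-≤ {x = x} {y} (cx , refl) (cy , refl) r with root-or-member _ cy
  ... | inj₁ refl = ≤-trans (dist-least {i = 0} refl) z≤n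
  ... | inj₂ xy   = dist-least {i = suc (dist x)} (inj₂ (xy , x , within-dist cx , r))

  level-zero : ∀ {x} → Level 0 x → x ≡ z
  level-zero {x} (cx , e) = subst (λ i → Within i x) e (within-dist cx)

  level-parent : ∀ {i x} → Level (suc i) x → ∃[ y ] (Level i y × R y x)
  level-parent {i} {x} l@(cx , e) with subst (λ i → Within i x) e (within-dist cx)
  ... | inj₁ w = contradiction (subst (_≤ i) e (dist-least w)) (<-irrefl refl)
  ... | inj₂ (_ , y , w , r) = y , (cy , ≤-antisym (dist-least w) (≤-pred (level-≤ (cy , refl) l r))) , r
    where cy = within⇒comp i w

  -- Related vertices lie in levels at most one apart, so all levels of one parity can share a
  -- palette.
  col-comp : ∀ {N} → (∀ i → Col R (Level i) N) → Col R Comp (2 * N)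
  col-comp {N} h = col-product (parity₂ ∘ dist) λ i → (λ x → proj₁ (h (dist x)) x) , proper i
    where
    proper : ∀ i {u v} → Comp u × parity₂ (dist u) ≡ i → Comp v × parity₂ (dist v) ≡ i → R u v →
             proj₁ (h (dist u)) u ≢ proj₁ (h (dist v)) v
    proper i {u} {v} (cu , refl) (cv , pe) r eq
      with m≤n⇒m<n∨m≡n (level-≤ (cu , refl) (cv , refl) r) | m≤n⇒m<n∨m≡n (level-≤ (cv , refl) (cu , refl) (R-sym r))
    ... | inj₂ e | _ = parity₂-suc (dist u) (trans (cong parity₂ (sym e)) pe)
    ... | inj₁ _ | inj₂ e = parity₂-suc (dist v) (trans (cong parity₂ (sym e)) (sym pe))
    ... | inj₁ a | inj₁ b = proj₂ (h (dist v)) (cu , du≡dv) (cv , refl) r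
            (trans (cong (λ i → proj₁ (h i) u) (sym du≡dv)) eq)
      where
      du≡dv : dist u ≡ dist v
      du≡dv = ≤-antisym (≤-pred b) (≤-pred a)

module _ {n : ℕ} {R : Fin n → Fin n → Set} (R? : ∀ x y → Dec (R x y)) (R-sym : ∀ {x y} → R x y → R y x) where

  -- Each vertex is coloured by the component of the least root that reaches it; components are
  -- closed under `R` in `X`, so related vertices have the same least root.
  col-by-comps : ∀ {X N} (X? : Decidable X) → Fin N →
                 (∀ z → X z → Col R (BFS.Comp R R? R-sym X X? z) N) → Col R X N
  col-by-comps {X} {N} X? d h = c , proper
    where
    open BFS R R? R-sym X X?
    P : Fin n → Fin n → Set
    P x z = X z × Comp z x

    P? : ∀ x → Decidable (P x)
    P? x z = X? z ×-dec comp? z x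

    rep : Fin n → Fin n
    rep x = find (P? x) x

    colour : ∀ z → Fin n → Fin N
    colour z x with X? z
    ... | yes xz = proj₁ (h z xz) x
    ... | no  _  = d

    c : Fin n → Fin N
    c x = colour (rep x) x

    least-rep : ∀ {x} → X x → P x (rep x) × (∀ y → P x y → toℕ (rep x) ≤ toℕ y)
    least-rep {x} xx = find-least (P? x) x (x , xx , comp-root x)

    proper : ∀ {u v} → X u → X v → R u v → c u ≢ c v
    proper {u} {v} xu xv r eq with least-rep xu | least-rep xv
    ... | (xzu , cu) , mu | (xzv , cv) , mv with
      toℕ-injective (≤-antisym (mu (rep v) (xzv , comp-closed _ cv (R-sym r) xu))
                               (mv (rep u) (xzu , comp-closed _ cu r xv)))
    ...   | e = differ (rep u) (rep v) e xzu cu eq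
      where
      differ : ∀ z z′ → z ≡ z′ → X z → Comp z u → colour z u ≢ colour z′ v
      differ z .z refl xz cu eq with X? z
      ... | yes xz′ = proj₂ (h z xz′) cu (comp-closed _ cu r xv) r eq
      ... | no ¬xz  = contradiction xz ¬xz

  col-by-levels : ∀ {X N} (X? : Decidable X) → Fin (2 * N) →
                  (∀ z → X z → ∀ i → Col R (BFS.Level R R? R-sym X X? z i) N) → Col R X (2 * N)
  col-by-levels X? d h = col-by-comps X? d λ z xz → BFS.col-comp R R? R-sym _ X? z (h z xz)

-- Colouring inside a P₄-free graph

module ChordalWalks {n : ℕ} (H : Fin n → Fin n → Set) (H-sym : ∀ {x y} → H x y → H y x)
  (H-P₄ : ∀ {a b c d} → H a b → H b c → H c d → ¬ H a c → ¬ H b d → H a d) where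

  double : ℕ → ℕ
  double zero    = zero
  double (suc d) = suc (suc (double d))

  -- A walk of `m` steps in which vertices may repeat; only chords of span two are excluded.
  -- Repetition matters, since the walk is later closed at the root.
  Chordless : ℕ → (ℕ → Fin n) → Set
  Chordless m f = ∀ t → (t < m → H (f t) (f (suc t))) × (suc t < m → ¬ H (f t) (f (suc (suc t))))

  chordless-init : ∀ {m f} → Chordless (suc (suc m)) f → Chordless m f
  chordless-init g t = (λ l → proj₁ (g t) (m≤n⇒m≤1+n (m≤n⇒m≤1+n l))) , (λ l → proj₂ (g t) (m≤n⇒m≤1+n (m≤n⇒m≤1+n l)))

  chordless-tail : ∀ {m f} → Chordless (suc (suc m)) f → Chordless m (λ t → f (suc (suc t)))
  chordless-tail g t = (λ l → proj₁ (g (suc (suc t))) (s≤s (s≤s l))) , (λ l → proj₂ (g (suc (suc t))) (s≤s (s≤s l)))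

  -- Writing m = 2d + 3, the vertices f 0, f (m - 2), f 2, f m would otherwise induce a P₄.
  odd-distance : ∀ d f → Chordless (suc (double d)) f → H (f 0) (f (suc (double d)))
  odd-distance zero    f g = proj₁ (g 0) ≤-refl
  odd-distance (suc d) f g = H-P₄
    (odd-distance d f (chordless-init g)) (H-sym (middle d g)) (odd-distance d _ (chordless-tail g))
    (proj₂ (g 0) (s≤s (s≤s z≤n))) (proj₂ (g (suc (double d))) ≤-refl)
    where
    middle : ∀ d → Chordless (suc (double (suc d))) f → H (f 2) (f (suc (double d)))
    middle zero    g = H-sym (proj₁ (g 1) (s≤s (s≤s z≤n)))
    middle (suc d) g = odd-distance d _ (chordless-init (chordless-tail g))

  cons : Fin n → (ℕ → Fin n) → ℕ → Fin n
  cons k g zero    = k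
  cons k g (suc t) = g t

  chordless-cons : ∀ {m k g} → H k (g 0) → (0 < m → ¬ H k (g 1)) → Chordless m g → Chordless (suc m) (cons k g)
  chordless-cons h h′ c zero    = (λ _ → h) , λ l → h′ (s≤s⁻¹ l)
  chordless-cons h h′ c (suc t) = (λ l → proj₁ (c t) (s≤s⁻¹ l)) , λ l → proj₂ (c t) (s≤s⁻¹ l)

-- In breadth-first search on F, a clique within one level has a common neighbour in the preceding level,
-- so levels have smaller clique number.
module LevelColouring {n : ℕ}
  (F : Fin n → Fin n → Set) (F? : ∀ x y → Dec (F x y)) (F-sym : ∀ {x y} → F x y → F y x)
  (H : Fin n → Fin n → Set) (H-sym : ∀ {x y} → H x y → H y x) (H-irr : ∀ {x} → ¬ H x x)
  (H-P₄ : ∀ {a b c d} → H a b → H b c → H c d → ¬ H a c → ¬ H b d → H a d)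
  (F⇒H : ∀ {x y} → F x y → H x y)
  (close : ∀ {x y z} → F x y → F y z → H x z → F x z)
  where

  open ChordalWalks H H-sym H-P₄

  module Levels (X : Fin n → Set) (X? : Decidable X) (z : Fin n) where
    open BFS F F? F-sym X X? z

    above? : ∀ x → Decidable (λ y → Comp y × suc (dist y) ≡ dist x × F y x)
    above? x y = comp? y ×-dec ((suc (dist y) ≟ dist x) ×-dec F? y x)

    parent : Fin n → Fin n
    parent x = find (above? x) x

    parent-ok : ∀ {i x} → Level (suc i) x → Level i (parent x) × F (parent x) x
    parent-ok {i} {x} l@(cx , e) with level-parent l
    ... | y , (cy , e′) , r with find-least (above? x) x (y , cy , trans (cong suc e′) (sym e) , r)
    ...   | (cp , e″ , r′) , _ = (cp , suc-injective (trans e″ e)) , r′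

    far-levels : ∀ {i x y} → Level i x → Level (suc (suc i)) y → ¬ F x y
    far-levels lx ly f = <-irrefl refl (level-≤ lx ly f)

    down : Fin n → ℕ → Fin n
    down k zero    = k
    down k (suc t) = down (parent k) t

    down-root : ∀ i {k} → Level i k → down k i ≡ z
    down-root zero    l = level-zero l
    down-root (suc i) l = down-root i (proj₁ (parent-ok l))

    -- By `close`, a chord of span two on a chain of parents would be an `F`-edge between levels two
    -- apart.
    down-chordless : ∀ i {k} → Level i k → Chordless i (down k)
    down-chordless zero    l t = (λ ()) , (λ ())
    down-chordless (suc zero) {k} l = λ where
      zero → (λ _ → F⇒H (F-sym (proj₂ (parent-ok l)))) , λ { (s≤s ()) }
      (suc t) → (λ { (s≤s ()) }) , λ { (s≤s ()) }
    down-chordless (suc (suc i)) {k} l with parent-ok l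
    ... | l′ , f with parent-ok l′
    ...   | l″ , f′ = λ where
      zero    → (λ _ → F⇒H (F-sym f)) , λ _ h → far-levels l″ l (close f′ f (H-sym h))
      (suc t) → (λ lt → proj₁ (down-chordless (suc i) l′ t) (s≤s⁻¹ lt)) ,
                (λ lt → proj₂ (down-chordless (suc i) l′ t) (s≤s⁻¹ lt))

    -- The walk z, …, parent p, p, k, g 0, g 1, … obtained by prepending the chain above p.
    climb : ∀ i {p k g m} → Level i p → Level (suc i) k → F p k → Chordless m (cons k g) →
            (0 < m → ¬ H p (g 0)) →
            ∃[ f ] (Chordless (suc i + m) f × f 0 ≡ z × (∀ t → f (suc i + t) ≡ cons k g t))
    climb zero {p} {k} {g} lp lk f c h =
      cons p (cons k g) , chordless-cons (F⇒H f) h c , level-zero lp , λ _ → refl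
    climb (suc i) {p} {k} {g} {m} lp lk f c h with parent-ok lp
    ... | lq , f′ with climb i {parent p} {p} {cons k g} {suc m} lq lp f′ (chordless-cons (F⇒H f) h c)
                         (λ _ hh → far-levels lq lk (close f′ f hh))
    ...   | w , cw , w0 , ws =
      w , subst (λ a → Chordless a w) (cong suc (+-suc i m)) cw , w0 ,
      λ t → trans (cong w (cong suc (sym (+-suc i t)))) (ws (suc t))

    -- Otherwise the closed walk from z via p, k, k′, p′ back to z has no short chord except at z.
    cross-parents : ∀ {i p p′ k k′} → Level i p → Level i p′ → Level (suc i) k → Level (suc i) k′ →
                    F p k → F p′ k′ → F k k′ → ¬ F p k′ → ¬ F p′ k → ⊥
    cross-parents {i} {p} {p′} {k} {k′} lp lp′ lk lk′ f f′ e ¬f ¬f′ with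
      climb i {g = cons k′ (down p′)} {m = suc (suc i)} lp lk f
        (chordless-cons (F⇒H e) (λ _ h → ¬f′ (F-sym (close e (F-sym f′) h)))
          (chordless-cons (F⇒H (F-sym f′)) second (down-chordless i lp′)))
        (λ _ h → ¬f (close f e h))
      where
      second : 0 < i → ¬ H k′ (parent p′)
      second lt h = go i lt lp′ lk′
        where
        go : ∀ i → 0 < i → Level i p′ → Level (suc i) k′ → ⊥
        go (suc i) _ l l′ = far-levels (proj₁ (parent-ok l)) l′
                              (close (proj₂ (parent-ok l)) f′ (H-sym h))
    -- The closed walk has 2i + 3 steps, an odd number, so `odd-distance` makes `z` adjacent to
    -- itself in `H`.
    ... | w , cw , w0 , ws = H-irr (subst (λ a → H a z) w0 (subst (H (w 0)) wz h))
      where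
      len : ∀ i → suc (i + suc (suc i)) ≡ suc (double (suc i))
      len zero    = refl
      len (suc i) = cong (λ a → suc (suc a)) (trans (+-suc i (suc (suc i))) (len i))

      h : H (w 0) (w (suc (double (suc i))))
      h = odd-distance (suc i) w (subst (λ a → Chordless a w) (len i) cw)

      wz : w (suc (double (suc i))) ≡ z
      wz = trans (cong w (sym (len i))) (trans (ws (suc (suc i))) (down-root i lp′))

    -- If the common parent `p` of the tail misses `k`, then the parent of `k` works for the whole
    -- clique: a tail vertex missed by it would contradict `cross-parents`.
    common-parent : ∀ {i} k K → All (Level (suc i)) (k ∷ K) → AllPairs F (k ∷ K) →
                    ∃[ p ] (Level i p × All (F p) (k ∷ K))
    common-parent k [] (l ∷ []) _ with parent-ok l
    ... | lp , f = parent k , lp , f ∷ []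
    common-parent {i} k (k′ ∷ K) (l ∷ ls) (fs ∷ ps) with common-parent k′ K ls ps
    ... | p , lp , gs with F? p k
    ...   | yes f = p , lp , f ∷ gs
    ...   | no ¬f with parent-ok l
    ...     | lq , f = parent k , lq , f ∷ shared (k′ ∷ K) ls fs gs
      where
      shared : ∀ K → All (Level (suc i)) K → All (F k) K → All (F p) K → All (F (parent k)) K
      shared [] _ _ _ = []
      shared (x ∷ K) (lx ∷ ls) (e ∷ es) (g ∷ gs) with F? (parent k) x
      ... | yes r = r ∷ shared K ls es gs
      ... | no ¬r = ⊥-elim (cross-parents lp lq lx l g f (F-sym e) ¬f ¬r)

    level-clique : ∀ {i w} → X z → CliqueBound F X (suc w) → CliqueBound F (Level (suc i)) w
    level-clique xz cb [] _ _ = z≤n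
    level-clique xz cb (k ∷ K) ps ls with common-parent k K ls ps
    ... | p , lp , fs = s≤s⁻¹ (cb (p ∷ k ∷ K) (fs ∷ ps) (comp-⊆ xz (proj₁ lp) ∷ All.map (comp-⊆ xz ∘ proj₁) ls))

  col-2^ : ∀ w X → Decidable X → CliqueBound F X (suc w) → Col F X (2 ^ w)
  col-2^ zero    X X? cb = edgeless zero λ {x} {y} xx xy f →
    contradiction (cb (x ∷ y ∷ []) ((f ∷ []) ∷ [] ∷ []) (xx ∷ xy ∷ [])) λ { (s≤s ()) }
  col-2^ (suc w) X X? cb = col-by-levels F? F-sym X? (element (m^n>0 2 (suc w))) level
    where
    level : ∀ z → X z → ∀ i → Col F (BFS.Level F F? F-sym X X? z i) (2 ^ w)
    level z xz zero    = edgeless (element (m^n>0 2 w)) λ lx ly f →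
      H-irr (subst (H _) (trans (L.level-zero ly) (sym (L.level-zero lx))) (F⇒H f))
      where module L = BFS F F? F-sym X X? z
    level z xz (suc i) = col-2^ w _ (BFS.level? F F? F-sym X X? z (suc i)) (Levels.level-clique X X? z xz cb)

-- Colouring a set dominated by a set of known parities

clash : ∀ {a b} → a ≡ b → ¬ b ≡ not a
clash {true}  refl ()
clash {false} refl ()

module Covering {n : ℕ} (G : Graph n) (w N : ℕ)
  (small : ∀ {X} → Decidable X → CliqueBound (Adj G) X w → Col (Adj G) X N)
  (cb : CliqueBound (Adj G) (λ _ → ⊤) (suc w)) where

  open Paths G

  -- The list `ds` holds only the interior, so the equation says that the path has odd length
  -- exactly when `τ p p′` is true.
  Parity : (P B : Fin n → Set) → (Fin n → Fin n → Bool) → Set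
  Parity P B τ = ∀ {p p′} ds → P p → P p′ → Far p p′ → Path p ds p′ → All B ds → odd ds ≡ not (τ p p′)

  -- Assign to each b the first vertex q b of P adjacent to it. The edges b b′ with τ (q b) (q b′) true are
  -- coloured properly first; in each colour class, the last parent of a clique is adjacent to all of it.
  module Stable {P B : Fin n → Set} (P? : Decidable P) (B? : Decidable B) (τ : Fin n → Fin n → Bool)
    (τ-sym : ∀ {x y} → P x → P y → τ x y ≡ true → τ y x ≡ true) (τ-irr : ∀ {x} → P x → τ x x ≡ false)
    (stable : ∀ {x y} → P x → P y → ¬ x ~ y)
    (cover : ∀ {b} → B b → ∃[ p ] (P p × p ~ b))
    (parity : Parity P B τ)
    (τ-P₄ : ∀ {a b c d} → P a → P b → P c → P d → τ a b ≡ true → τ b c ≡ true → τ c d ≡ true →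
            τ a c ≡ false → τ b d ≡ false → τ a d ≡ true)
    where

    above? : ∀ b → Decidable (λ p → P p × p ~ b)
    above? b p = P? p ×-dec (p ~? b)

    q : Fin n → Fin n
    q b = find (above? b) b

    q-ok : ∀ {b} → B b → P (q b) × q b ~ b
    q-ok {b} bb = proj₁ (find-least (above? b) b (cover bb))

    q-least : ∀ {b p} → B b → P p → p ~ b → toℕ (q b) ≤ toℕ p
    q-least {b} bb pp e = proj₂ (find-least (above? b) b (cover bb)) _ (pp , e)

    P-B : ∀ {p b} → P p → B b → p ≢ b
    P-B pp bb refl = stable (proj₁ (q-ok bb)) pp (proj₂ (q-ok bb))

    far : ∀ {x y} → P x → P y → x ≢ y → Far x y
    far px py x≢y = stable px py , x≢y

    odd⇒≢ : ∀ {x y} → P x → τ x y ≡ true → x ≢ y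
    odd⇒≢ px t refl with trans (sym t) (τ-irr px)
    ... | ()

    -- A common neighbour in `B` would give an induced path of length two between an odd pair.
    no-common : ∀ {x y b} → P x → P y → B b → τ x y ≡ true → x ~ b → ¬ y ~ b
    no-common {x} {y} {b} px py bb t e e′ = clash t (parity [ b ] px py f (e , [] , f , ~-sym e′) (bb ∷ []))
      where f = far px py (odd⇒≢ px t)

    H : Fin n → Fin n → Set
    H x y = B x × B y × τ (q x) (q y) ≡ true

    H-sym : ∀ {x y} → H x y → H y x
    H-sym (bx , by , t) = by , bx , τ-sym (proj₁ (q-ok bx)) (proj₁ (q-ok by)) t

    H-irr : ∀ {x} → ¬ H x x
    H-irr (bx , _ , t) = odd⇒≢ (proj₁ (q-ok bx)) t refl

    even : ∀ {x y} → B x → B y → ¬ H x y → τ (q x) (q y) ≡ false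
    even bx by ¬h = Bool.¬-not λ t → ¬h (bx , by , t)

    H-P₄ : ∀ {a b c d} → H a b → H b c → H c d → ¬ H a c → ¬ H b d → H a d
    H-P₄ (ba , bb , t) (_ , bc , t′) (_ , bd , t″) ¬h ¬h′ =
      ba , bd , τ-P₄ (p ba) (p bb) (p bc) (p bd) t t′ t″ (even ba bc ¬h) (even bb bd ¬h′)
      where
      p : ∀ {b} → B b → P (q b)
      p = proj₁ ∘ q-ok

    F : Fin n → Fin n → Set
    F x y = x ~ y × H x y

    F? : ∀ x y → Dec (F x y)
    F? x y = (x ~? y) ×-dec (B? x ×-dec (B? y ×-dec (τ (q x) (q y) Bool.≟ true)))

    -- If `x` and `z` were not adjacent, then `q x`, `x`, `y`, `z`, `q z` would be an induced path
    -- of length four between an odd pair; `no-common` excludes all its chords at `q x` and `q z`.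
    close : ∀ {x y z} → F x y → F y z → H x z → F x z
    close {x} {y} {z} (x~y , bx , by , t) (y~z , _ , bz , t′) h@(_ , _ , t″) with x ~? z
    ... | yes e = e , h
    ... | no ¬e = contradiction (parity (x ∷ y ∷ z ∷ []) px pz fxz
      (qx , (nc px py by t qy , P-B px by) ∷ (nc px pz bz t″ qz , P-B px bz) ∷ [] , fxz ,
        x~y , (¬e , λ { refl → H-irr h }) ∷ [] , (nc pz px bx (τ-sym px pz t″) qx ∘ ~-sym , P-B pz bx ∘ sym) ,
        y~z , [] , (nc pz py by (τ-sym py pz t′) qy ∘ ~-sym , P-B pz by ∘ sym) , ~-sym qz)
      (bx ∷ by ∷ bz ∷ [])) (clash t″)
      where
      px = proj₁ (q-ok bx)
      py = proj₁ (q-ok by)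
      pz = proj₁ (q-ok bz)
      qx = proj₂ (q-ok bx)
      qy = proj₂ (q-ok by)
      qz = proj₂ (q-ok bz)
      fxz = far px pz (odd⇒≢ px t″)
      nc : ∀ {a c b} → P a → P c → B b → τ a c ≡ true → c ~ b → ¬ a ~ b
      nc pa pc bb t e e′ = no-common pa pc bb t e′ e

    module LC = LevelColouring F F? (λ (e , h) → ~-sym e , H-sym h) H H-sym H-irr H-P₄ proj₂ close

    colF : Col F B (2 ^ w)
    colF = LC.col-2^ w B B? λ K ps _ → cb K (AllPairs.map proj₁ ps) (All.universal (λ _ → tt) K)

    module Class (i : Fin (2 ^ w)) where

      Y : Fin n → Set
      Y b = B b × proj₁ colF b ≡ i

      -- Otherwise `q x`, `x`, `y`, `q y` is an induced path of length three, although the pair of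
      -- parents is even inside a colour class. The chord from `q x` to `y` is excluded because
      -- `q y` is the first parent of `y`.
      later : ∀ {x y} → Y x → Y y → x ~ y → toℕ (q x) ≤ toℕ (q y) → q y ~ x
      later {x} {y} (bx , cx) (by , cy) e l with q x ≟ᶠ q y
      ... | yes eq = subst (_~ x) eq (proj₂ (q-ok bx))
      ... | no ¬eq with q y ~? x
      ...   | yes r = r
      ...   | no ¬r = contradiction (parity (x ∷ y ∷ []) px py f
        (proj₂ (q-ok bx) , ((λ e′ → ¬eq (toℕ-injective (≤-antisym l (q-least by px e′)))) , P-B px by) ∷ [] , f ,
          e , [] , (¬r ∘ ~-sym , P-B py bx ∘ sym) , ~-sym (proj₂ (q-ok by)))
        (bx ∷ by ∷ [])) (clash (even bx by (λ h → proj₂ colF bx by (e , h) (trans cx (sym cy)))))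
        where
        px = proj₁ (q-ok bx)
        py = proj₁ (q-ok by)
        f = far px py ¬eq

      -- The vertex `m` is one with `q m` latest, so `later` applies to every other member. The
      -- clause over all `Q` encodes that `m` lies in the list.
      last-parent : ∀ k K → All Y (k ∷ K) → AllPairs _~_ (k ∷ K) →
                    ∃[ m ] (Y m × (∀ {Q : Fin n → Set} → All Q (k ∷ K) → Q m)
                            × All (λ x → q m ~ x × toℕ (q x) ≤ toℕ (q m)) (k ∷ K))
      last-parent k [] (y ∷ []) _ = k , y , (λ { (x ∷ _) → x }) , (proj₂ (q-ok (proj₁ y)) , ≤-refl) ∷ []
      last-parent k (k′ ∷ K) (y ∷ ys) (es ∷ ps) with last-parent k′ K ys ps
      ... | m , ym , at , all with toℕ (q k) ≤? toℕ (q m)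
      ...   | yes l = m , ym , (λ { (_ ∷ xs) → at xs }) , (later y ym (at es) l , l) ∷ all
      ...   | no ¬l = k , y , (λ { (x ∷ _) → x }) ,
        (proj₂ (q-ok (proj₁ y)) , ≤-refl) ∷ raise (k′ ∷ K) ys es all
        where
        raise : ∀ K → All Y K → All (k ~_) K → All (λ x → q m ~ x × toℕ (q x) ≤ toℕ (q m)) K →
                All (λ x → q k ~ x × toℕ (q x) ≤ toℕ (q k)) K
        raise [] _ _ _ = []
        raise (x ∷ K) (yx ∷ ys) (e ∷ es) ((_ , l) ∷ all) =
          (later yx y (~-sym e) l′ , l′) ∷ raise K ys es all
          where l′ = ≤-trans l (<⇒≤ (≰⇒> ¬l))

      clique : CliqueBound _~_ Y w
      clique [] _ _ = z≤n
      clique (k ∷ K) ps ys with last-parent k K ys ps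
      ... | m , _ , _ , all = s≤s⁻¹ (cb (q m ∷ k ∷ K) (All.map proj₁ all ∷ ps) (All.universal (λ _ → tt) _))

    col-stable : Col _~_ B (2 ^ w * N)
    col-stable = col-product (proj₁ colF) λ i →
      small (λ x → B? x ×-dec (proj₁ colF x ≟ᶠ i)) (Class.clique i)

  module _ {P B : Fin n → Set} (P? : Decidable P) (B? : Decidable B) (τ : Fin n → Fin n → Bool)
    (τ-sym : ∀ {x y} → P x → P y → τ x y ≡ true → τ y x ≡ true) (τ-irr : ∀ {x} → P x → τ x x ≡ false)
    (cover : ∀ {b} → B b → ∃[ p ] (P p × p ~ b))
    (parity : Parity P B τ)
    (τ-P₄ : ∀ {a b c d} → P a → P b → P c → P d → ¬ a ~ b → ¬ b ~ c → ¬ c ~ d →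
            τ a b ≡ true → τ b c ≡ true → τ c d ≡ true → τ a c ≡ false → τ b d ≡ false → τ a d ≡ true)
    where

    -- Splitting `B` by the colour of a chosen parent leaves a stable covering set in each class, at
    -- the cost of the factor `M`. This is also why `τ-P₄` is asked only when consecutive vertices
    -- are not adjacent.
    col-cover : ∀ {M} → Col _~_ P M → Col _~_ B (M * (2 ^ w * N))
    col-cover (c , proper) = col-product (c ∘ r) λ i →
      Stable.col-stable (λ x → P? x ×-dec (c x ≟ᶠ i)) (λ x → B? x ×-dec (c (r x) ≟ᶠ i)) τ
        (λ x y → τ-sym (proj₁ x) (proj₁ y)) (τ-irr ∘ proj₁)
        stable
        (λ { {b} (bb , e) → r b , (proj₁ (r-ok bb) , e) , proj₂ (r-ok bb) })
        (λ ds p p′ f π bs → parity ds (proj₁ p) (proj₁ p′) f π (All.map proj₁ bs))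
        (λ a b c d → τ-P₄ (proj₁ a) (proj₁ b) (proj₁ c) (proj₁ d) (stable a b) (stable b c) (stable c d))
      where
      r : Fin n → Fin n
      r b = find (λ p → P? p ×-dec (p ~? b)) b

      r-ok : ∀ {b} → B b → P (r b) × r b ~ b
      r-ok {b} bb = proj₁ (find-least (λ p → P? p ×-dec (p ~? b)) b (cover bb))

      stable : ∀ {i x y} → P x × c x ≡ i → P y × c y ≡ i → ¬ x ~ y
      stable (px , e) (py , e′) x~y = proper px py x~y (trans e (sym e′))

-- Levellings

record Levelling {n} (G : Graph n) : Set₁ where
  open Paths G
  field
    Λ        : ℕ → Fin n → Set
    Λ?       : ∀ i → Decidable (Λ i)
    disjoint : ∀ {i j x} → Λ i x → Λ j x → i ≡ j
    distant  : ∀ {i j x y} → Λ i x → Λ j y → suc i < j → ¬ x ~ y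
    apex     : ∀ {x y} → Λ 0 x → Λ 0 y → x ≡ y
    up       : ∀ {i x} → Λ (suc i) x → ∃[ y ] (Λ i y × y ~ x)

module Links {n} {G : Graph n} (L : Levelling G) where
  open Paths G
  open Levelling L public

  Below : ℕ → Fin n → Set
  Below i u = ∃[ j ] (j < i × Λ j u)

  far : ∀ {i j x y} → Λ i x → Λ j y → suc i < j → Far x y
  far l l′ lt = distant l l′ lt , λ { refl → <-irrefl (disjoint l l′) (≤-trans (n≤1+n _) lt) }

  below-far : ∀ {i u x} → Below i u → Λ (suc i) x → Far u x
  below-far (j , lt , l) l′ = far l l′ (s≤s lt)

  level-≢ : ∀ {i x y} → Λ i x → Λ (suc i) y → x ≢ y
  level-≢ l l′ refl with disjoint l l′
  ... | ()

  above? : ∀ i x → Decidable (λ y → Λ i y × y ~ x)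
  above? i x y = Λ? i y ×-dec (y ~? x)

  parent : ℕ → Fin n → Fin n
  parent i x = find (above? i x) x

  parent-ok : ∀ {i x} → Λ (suc i) x → Λ i (parent i x) × parent i x ~ x
  parent-ok {i} {x} l = proj₁ (find-least (above? i x) x (up l))

  -- Link i x y π: a particular kind of induced path between the vertices x and y of level i,
  -- with interior in the levels above; its length is odd iff π is true.
  data Link : ℕ → Fin n → Fin n → Bool → Set where
    share : ∀ {i x y p} → Λ (suc i) x → Λ (suc i) y → Far x y → Λ i p → p ~ x → p ~ y → Link (suc i) x y false
    cross : ∀ {i x y p p′} → Λ (suc i) x → Λ (suc i) y → Far x y → Λ i p → Λ i p′ → p ~ x → p′ ~ y →
            ¬ p ~ y → ¬ p′ ~ x → p ~ p′ → Link (suc i) x y true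
    climb : ∀ {i x y p p′ π} → Λ (suc i) x → Λ (suc i) y → Far x y → Λ i p → Λ i p′ → p ~ x → p′ ~ y →
            ¬ p ~ y → ¬ p′ ~ x → Link i p p′ π → Link (suc i) x y π

  link-far : ∀ {i x y π} → Link i x y π → Far x y
  link-far (share _ _ f _ _ _)           = f
  link-far (cross _ _ f _ _ _ _ _ _ _) = f
  link-far (climb _ _ f _ _ _ _ _ _ _) = f

  link-path : ∀ {i x y π} → Link i x y π → ∃[ ps ] (Path x ps y × odd ps ≡ not π × All (Below i) ps)
  link-path (share {p = p} _ _ f l e e′) =
    [ p ] , (~-sym e , [] , f , e′) , refl , (_ , n<1+n _ , l) ∷ []
  link-path (cross {p = p} {p′} lx ly f l l′ e e′ ¬e ¬e′ r) =
    p ∷ p′ ∷ [] , (~-sym e , (¬e′ ∘ ~-sym , level-≢ l′ lx ∘ sym) ∷ [] , f , r , [] , (¬e , level-≢ l ly) , e′) ,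
    refl , (_ , n<1+n _ , l) ∷ (_ , n<1+n _ , l′) ∷ []
  link-path (climb {p = p} {p′} lx ly f l l′ e e′ ¬e ¬e′ r) with link-path r
  ... | ps , ρ , o , b =
    p ∷ (ps ∷ʳ p′) ,
    (~-sym e , ++⁺ (All.map (λ u → Far-sym (below-far u lx)) b) ((¬e′ ∘ ~-sym , level-≢ l′ lx ∘ sym) ∷ []) , f ,
      snoc ps ρ e′ (All.map (λ u → Far-sym (below-far u ly)) b) (Far-sym (¬e , level-≢ l ly))) ,
    trans (cong not (trans (odd-∷ʳ ps) (cong not o))) (Bool.not-involutive _) ,
    (_ , n<1+n _ , l) ∷ ++⁺ (All.map (λ (j , lt , lj) → j , m<n⇒m<1+n lt , lj) b) ((_ , n<1+n _ , l′) ∷ [])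

  -- The parity of Link i x y, computed from the chosen parents; true also when x and y are adjacent.
  τ : ℕ → Fin n → Fin n → Bool
  τ zero    x y = false
  τ (suc i) x y with x ~? y | parent i x ~? y | parent i y ~? x
  ... | yes _ | _     | _     = true
  ... | no _  | yes _ | _     = false
  ... | no _  | no _  | yes _ = false
  ... | no _  | no _  | no _  = τ i (parent i x) (parent i y)

  τ-adj : ∀ {i x y} → Λ i x → Λ i y → x ~ y → τ i x y ≡ true
  τ-adj {zero}  lx ly e with apex lx ly
  ... | refl = contradiction e ~-irr
  τ-adj {suc i} {x} {y} lx ly e with x ~? y
  ... | yes _ = refl
  ... | no ¬e = contradiction e ¬e

  τ-irr : ∀ {i x} → Λ i x → τ i x x ≡ false
  τ-irr {zero}  l = refl
  τ-irr {suc i} {x} l with x ~? x | parent i x ~? x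
  ... | yes e | _     = contradiction e ~-irr
  ... | no _  | yes _ = refl
  ... | no _  | no ¬e = contradiction (proj₂ (parent-ok l)) ¬e

  τ-sym : ∀ i x y → τ i x y ≡ τ i y x
  τ-sym zero    x y = refl
  τ-sym (suc i) x y with x ~? y | y ~? x | parent i x ~? y | parent i y ~? x
  ... | yes _ | yes _ | _     | _     = refl
  ... | yes e | no ¬e | _     | _     = contradiction (~-sym e) ¬e
  ... | no ¬e | yes e | _     | _     = contradiction (~-sym e) ¬e
  ... | no _  | no _  | yes _ | yes _ = refl
  ... | no _  | no _  | yes _ | no _  = refl
  ... | no _  | no _  | no _  | yes _ = refl
  ... | no _  | no _  | no _  | no _  = τ-sym i (parent i x) (parent i y)

  link : ∀ i {x y} → Λ i x → Λ i y → Far x y → Link i x y (τ i x y)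
  link zero lx ly (_ , x≢y) = contradiction (apex lx ly) x≢y
  link (suc i) {x} {y} lx ly f with x ~? y | parent i x ~? y | parent i y ~? x
  ... | yes e | _     | _      = contradiction e (proj₁ f)
  ... | no _  | yes e | _      = share lx ly f (proj₁ (parent-ok lx)) (proj₂ (parent-ok lx)) e
  ... | no _  | no _  | yes e  = share lx ly f (proj₁ (parent-ok ly)) e (proj₂ (parent-ok ly))
  ... | no _  | no ¬e | no ¬e′ with parent-ok lx | parent-ok ly
  ...   | lp , e | lp′ , e′ with parent i x ~? parent i y
  ...     | yes r = subst (Link _ _ _) (sym (τ-adj lp lp′ r)) (cross lx ly f lp lp′ e e′ ¬e ¬e′ r)
  ...     | no ¬r = climb lx ly f lp lp′ e e′ ¬e ¬e′ (link i lp lp′ (¬r , λ eq → ¬e (subst (_~ y) (sym eq) e′)))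

  link-parity : OddHoleFree → ∀ {i x y π} {B : Fin n → Set} → (∀ {u b} → Below i u → B b → Far u b) →
                Link i x y π → ∀ ds → Path x ds y → All B ds → odd ds ≡ not π
  link-parity ohf {B = B} bf l ds δ bs with link-path l | reverse ds δ
  ... | ps , ρ , o , b | ds′ , δ′ , o′ , tr =
    trans (trans (sym o′) (sym (theta ohf ps ds′ ρ δ′ (link-far l) (All.map (λ u → All.map (bf u) (tr bs)) b)))) o

-- The part of G below the last level: a connected set Floor together with private children.
record Grounded {n} {G : Graph n} (L : Levelling G) (m : ℕ) : Set₁ where
  open Paths G
  open Levelling L
  field
    Floor     : Fin n → Set
    floor?    : Decidable Floor
    floor-far : ∀ {i x b} → Λ i x → i < m → Floor b → Far x b
    connected : ∀ {a b} → Floor a → Floor b → Star (Edge Floor) a b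
    bottom    : ∀ {x} → Λ m x → ∃[ b ] (Floor b × x ~ b)
    child     : ∀ {i x} → i < m → Λ i x → ∃[ c ] (Λ (suc i) c × x ~ c × (∀ {y} → Λ i y → y ~ c → y ≡ x))

module Ground {n} {G : Graph n} (L : Levelling G) {m} (Gr : Grounded L m) (ohf : Paths.OddHoleFree G) where
  open Paths G
  open Links L public
  open Grounded Gr public

  Under : ℕ → Fin n → Set
  Under j z = (∃[ l ] (j < l × Λ l z)) ⊎ Floor z

  descend : ∀ t {j x} → j + t ≡ m → Λ j x → ∃[ b ] (Floor b × Star (Edge (Under j)) x b)
  descend zero {j} e l with trans (sym (+-identityʳ j)) e
  ... | refl with bottom l
  ...   | b , fb , r = b , fb , (r , inj₂ fb) ◅ ε
  descend (suc t) {j} e l with child (subst (j <_) (trans (sym (+-suc j t)) e) (s≤s (m≤m+n j t))) l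
  ... | c , lc , r , _ with descend t (trans (sym (+-suc j t)) e) lc
  ...   | b , fb , w = b , fb , (r , inj₁ (suc j , ≤-refl , lc)) ◅ walk-map
    (λ { (inj₁ (l , lt , z)) → inj₁ (l , <⇒≤ lt , z) ; (inj₂ z) → inj₂ z }) w

  floor-far-below : ∀ {i u b} → i ≤ m → Below i u → Floor b → Far u b
  floor-far-below le (j , lt , l) = floor-far l (≤-trans lt le)

  -- Vertices with no neighbour in the levels up to i, other than x and y.
  Clear : ℕ → Fin n → Fin n → Fin n → Set
  Clear i x y z = ∀ {u} → Below i u ⊎ (Λ i u × u ≢ x × u ≢ y) → Far u z

  under-clear : ∀ {i x y z} → i < m → Under (suc i) z → Clear i x y z
  under-clear lt (inj₁ (l , lt′ , lz)) (inj₁ (j , lt″ , lj)) = far lj lz (≤-trans (s≤s (s≤s (<⇒≤ lt″))) lt′)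
  under-clear lt (inj₁ (l , lt′ , lz)) (inj₂ (lu , _)) = far lu lz lt′
  under-clear lt (inj₂ fz) (inj₁ b)  = floor-far-below (<⇒≤ lt) b fz
  under-clear lt (inj₂ fz) (inj₂ (lu , _)) = floor-far lu lt fz

  child-clear : ∀ {i x x′ y c} → (∀ {u} → u ≢ x → u ≢ y → u ≢ x′) → Λ (suc i) c →
                (∀ {u} → Λ i u → u ~ c → u ≡ x′) → Clear i x y c
  child-clear sel lc only (inj₁ b) = below-far b lc
  child-clear sel lc only (inj₂ (lu , u≢x , u≢y)) = (λ e → sel u≢x u≢y (only lu e)) , level-≢ lu lc

  -- The walk leaves `y` and enters `x` through private children, which see no other vertex of level
  -- `i`; the rest runs at least two levels below or in `Floor`.
  via-clear : ∀ {i x y} → i < m → Λ i x → Λ i y → Via (Clear i x y) y x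
  via-clear {i} {x} {y} lt lx ly with child lt lx | child lt ly
  ... | c , lc , e , only | d , ld , e′ , only′ with descend _ (m+[n∸m]≡n lt) lc | descend _ (m+[n∸m]≡n lt) ld
  ...   | b , fb , w | b′ , fb′ , w′ = via e′ dclear
    (walk-map (under-clear lt) w′ ◅◅ walk-map (λ z → under-clear lt (inj₂ z)) (connected fb′ fb) ◅◅
      reverse-walk (λ {u} → child-clear (λ a _ → a) lc only {u}) (walk-map (under-clear lt) w)) (~-sym e)
    where
    dclear : Clear i x y d
    dclear = child-clear (λ _ a → a) ld only′

  via-floor : ∀ {x y} → Λ m x → Λ m y → Via Floor y x
  via-floor lx ly with bottom lx | bottom ly
  ... | b , fb , e | b′ , fb′ , e′ = via e′ fb′ (connected fb′ fb) (~-sym e)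

  -- The path and the link are both compared with the return walk of `via-clear`. Unlike a link, the
  -- path may use further vertices of level `i`.
  link-vs-path : ∀ {i x y π} → i < m → Λ i x → Λ i y → Link i x y π → ∀ ps → Path x ps y →
                 All (λ u → Below i u ⊎ (Λ i u × u ≢ x × u ≢ y)) ps → odd ps ≡ not π
  link-vs-path lt lx ly l ps π h with link-path l
  ... | qs , ρ , o , b = trans
    (same-parity ohf (link-far l) (via-clear lt lx ly) ps qs π ρ
      (All.map (λ u v c → c u) h) (All.map (λ u v c → c (inj₁ u)) b)) o

  -- On level `m` the return walk runs through `Floor` directly; interiors of links stay in earlier
  -- levels and are therefore far from it.
  link-unique : ∀ {i x y π π′} → i ≤ m → Λ i x → Λ i y → Link i x y π → Link i x y π′ → π ≡ π′
  link-unique le lx ly l l′ with m≤n⇒m<n∨m≡n le | link-path l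
  ... | inj₁ lt   | qs , ρ , o , b = Bool.not-injective (trans (sym o) (link-vs-path lt lx ly l′ qs ρ (All.map inj₁ b)))
  ... | inj₂ refl | qs , ρ , o , b with link-path l′
  ...   | qs′ , ρ′ , o′ , b′ = Bool.not-injective (trans (sym o) (trans
    (same-parity ohf (link-far l) (via-floor lx ly) qs qs′ ρ ρ′
      (All.map (λ u v → floor-far-below ≤-refl u) b) (All.map (λ u v → floor-far-below ≤-refl u) b′)) o′))

  true≢false : ∀ {b} → b ≡ true → b ≢ false
  true≢false refl ()

  module Step (i : ℕ) (le : suc i ≤ m) where

    τ-≁ : ∀ {x y} → Λ (suc i) x → Λ (suc i) y → τ (suc i) x y ≡ false → ¬ x ~ y
    τ-≁ lx ly t e = true≢false (τ-adj lx ly e) t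

    τ-≢ : ∀ {x y} → Λ (suc i) x → τ (suc i) x y ≡ true → x ≢ y
    τ-≢ lx t refl = true≢false t (τ-irr lx)

    -- The parents `p`, `p′` yield a link of their own, and by `link-unique` it has the parity
    -- computed from the chosen parents.
    lift : ∀ {x y p p′} → Λ (suc i) x → Λ (suc i) y → Far x y → Λ i p → Λ i p′ → p ~ x → p′ ~ y →
           ¬ p ~ y → ¬ p′ ~ x → τ i p p′ ≡ τ (suc i) x y
    lift {x} {y} {p} {p′} lx ly f lp lp′ e e′ ¬e ¬e′ with p ~? p′
    ... | yes r = trans (τ-adj lp lp′ r)
          (link-unique le lx ly (cross lx ly f lp lp′ e e′ ¬e ¬e′ r) (link (suc i) lx ly f))
    ... | no ¬r = link-unique le lx ly
          (climb lx ly f lp lp′ e e′ ¬e ¬e′ (link i lp lp′ (¬r , λ { refl → ¬e e′ }))) (link (suc i) lx ly f)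

    odd-unshared : ∀ {x y p} → Λ (suc i) x → Λ (suc i) y → Far x y → τ (suc i) x y ≡ true → Λ i p → p ~ x → ¬ p ~ y
    odd-unshared lx ly f t lp e e′ =
      true≢false t (sym (link-unique le lx ly (share lx ly f lp e e′) (link (suc i) lx ly f)))

    odd-up : ∀ {x y p p′} → Λ (suc i) x → Λ (suc i) y → ¬ x ~ y → τ (suc i) x y ≡ true →
             Λ i p → Λ i p′ → p ~ x → p′ ~ y → τ i p p′ ≡ true
    odd-up {x} {y} lx ly x≁y t lp lp′ e e′ = trans
      (lift lx ly f lp lp′ e e′ (odd-unshared lx ly f t lp e)
        (odd-unshared ly lx (Far-sym f) (trans (τ-sym (suc i) y x) t) lp′ e′)) t
      where f = x≁y , τ-≢ lx t

    -- A shared parent, taken twice, counts as an even pair.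
    even-parents : ∀ {x y} → Λ (suc i) x → Λ (suc i) y → τ (suc i) x y ≡ false →
                   ∃[ p ] ∃[ p′ ] (Λ i p × Λ i p′ × p ~ x × p′ ~ y × τ i p p′ ≡ false)
    even-parents {x} {y} lx ly t = go (parent i x ~? y) (parent i y ~? x)
      where
      lp  = proj₁ (parent-ok lx)
      e   = proj₂ (parent-ok lx)
      lp′ = proj₁ (parent-ok ly)
      e′  = proj₂ (parent-ok ly)

      go : Dec (parent i x ~ y) → Dec (parent i y ~ x) →
           ∃[ p ] ∃[ p′ ] (Λ i p × Λ i p′ × p ~ x × p′ ~ y × τ i p p′ ≡ false)
      go (yes r) _        = _ , _ , lp , lp , e , r , τ-irr lp
      go (no _)  (yes r)  = _ , _ , lp′ , lp′ , r , e′ , τ-irr lp′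
      go (no ¬r) (no ¬r′) = _ , _ , lp , lp′ , e , e′ ,
        trans (lift lx ly (τ-≁ lx ly t , λ { refl → ¬r e }) lp lp′ e e′ ¬r ¬r′) t

    -- Take even parents `p`, `r` of `a`, `c` and `q`, `s` of `b`, `d`. If `a`, `d` were even, `p`,
    -- `q`, `r`, `s` would violate P₄-freeness one level up; if `p` sees `d` or `s` sees `a`,
    -- `odd-up` makes `r`, `p` or `s`, `q` an odd pair.
    P₄-step : (∀ {a b c d} → Λ i a → Λ i b → Λ i c → Λ i d → τ i a b ≡ true → τ i b c ≡ true → τ i c d ≡ true →
               τ i a c ≡ false → τ i b d ≡ false → τ i a d ≡ true) →
              ∀ {a b c d} → Λ (suc i) a → Λ (suc i) b → Λ (suc i) c → Λ (suc i) d → ¬ a ~ b → ¬ b ~ c → ¬ c ~ d →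
              τ (suc i) a b ≡ true → τ (suc i) b c ≡ true → τ (suc i) c d ≡ true →
              τ (suc i) a c ≡ false → τ (suc i) b d ≡ false → τ (suc i) a d ≡ true
    P₄-step ih {a} {b} {c} {d} la lb lc ld a≁b b≁c c≁d ab bc cd ac bd
      with even-parents la lc ac | even-parents lb ld bd
    ... | p , r , lp , lr , pa , rc , pr | q , s , lq , ls , qb , sd , qs with τ (suc i) a d in ad
    ...   | true  = refl
    ...   | false with p ~? d | s ~? a
    ...     | yes pd | _ = contradiction (trans (τ-sym i p r) (odd-up lc ld c≁d cd lr lp rc pd)) λ t → true≢false t pr
    ...     | no _ | yes sa = contradiction (trans (τ-sym i q s) (odd-up la lb a≁b ab ls lq sa qb)) λ t → true≢false t qs
    ...     | no ¬pd | no ¬sa = contradiction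
      (trans (lift la ld (τ-≁ la ld ad , λ { refl → ¬pd pa }) lp ls pa sd ¬pd ¬sa) ad)
      (true≢false (ih lp lq lr ls (odd-up la lb a≁b ab lp lq pa qb) (odd-up lb lc b≁c bc lq lr qb rc)
                     (odd-up lc ld c≁d cd lr ls rc sd) pr qs))

  -- Only levels 1 to m - 1 are concerned: comparison with arbitrary paths inside the level needs
  -- private children in the next one.
  Twins : Set
  Twins = ∀ {i x y p} → suc i < m → Λ (suc i) x → Λ (suc i) y → x ~ y → Λ i p → p ~ x → p ~ y

  -- P₄-freeness and colourings when adjacent vertices have the same parents

  module WithTwins (twins : Twins) where

    -- Having the same parents, `u` and `v` have the same parity to `w`, since both parities lift
    -- from the same pair of parents.
    mixed : ∀ {i u v w} → suc i < m → Λ (suc i) u → Λ (suc i) v → Λ (suc i) w → u ~ v → ¬ v ~ w →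
            τ (suc i) v w ≡ true → τ (suc i) u w ≢ false
    mixed {i} {u} {v} {w} lt lu lv lw e ¬e t t′ with parent-ok lv | parent-ok lw
    ... | lp , pv | lq , qw = true≢false (odd-up lv lw ¬e t lp lq pv qw) (trans
        (lift lu lw (τ-≁ lu lw t′ , λ { refl → ¬e (~-sym e) }) lp lq (twins lt lv lu (~-sym e) lp pv) qw
          (odd-unshared lv lw f t lp pv)
          (λ r → odd-unshared lw lv (Far-sym f) (trans (τ-sym (suc i) w v) t) lq qw (twins lt lu lv e lq r))) t′)
      where
      open Step i (<⇒≤ lt)
      f = ¬e , τ-≢ lv t

    P₄ : ∀ i {a b c d} → i < m → Λ i a → Λ i b → Λ i c → Λ i d → τ i a b ≡ true → τ i b c ≡ true → τ i c d ≡ true →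
         τ i a c ≡ false → τ i b d ≡ false → τ i a d ≡ true
    P₄ zero lt la lb lc ld () bc cd ac bd
    P₄ (suc i) {a} {b} {c} {d} lt la lb lc ld ab bc cd ac bd = go (a ~? b) (b ~? c) (c ~? d)
      where
      open Step i (<⇒≤ lt)

      -- Passing along the edges, `twins` gives `a` and `d` a common parent, so their link is even,
      -- against the induced path `a`, `b`, `c`, `d` of length three.
      induced : a ~ b → b ~ c → c ~ d → Dec (a ~ d) → Dec (a ≡ c) → Dec (b ≡ d) → τ (suc i) a d ≡ true
      induced e e′ e″ (yes r) _          _          = τ-adj la ld r
      induced e e′ e″ (no _)  (yes refl) _          = cd
      induced e e′ e″ (no _)  (no _)     (yes refl) = ab
      induced e e′ e″ (no ¬r) (no a≢c)   (no b≢d)   = contradiction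
        (link-vs-path lt la ld (share la ld f lp pa pd) (b ∷ c ∷ [])
          (e , (a≁c , a≢c) ∷ [] , f , e′ , [] , (τ-≁ lb ld bd , b≢d) , e″)
          (inj₂ (lb , ~⇒≢ (~-sym e) , b≢d) ∷ inj₂ (lc , a≢c ∘ sym , ~⇒≢ e″) ∷ []))
        λ ()
        where
        a≁c = τ-≁ la lc ac
        lp = proj₁ (parent-ok la)
        pa = proj₂ (parent-ok la)
        f : Far a d
        f = ¬r , λ { refl → a≁c (~-sym e″) }
        pd : parent i a ~ d
        pd = twins lt lc ld e″ lp (twins lt lb lc e′ lp (twins lt la lb e lp pa))

      go : Dec (a ~ b) → Dec (b ~ c) → Dec (c ~ d) → τ (suc i) a d ≡ true
      go (yes e) (no ¬e) _       = ⊥-elim (mixed lt la lb lc e ¬e bc ac)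
      go _       (yes e) (no ¬e) = ⊥-elim (mixed lt lb lc ld e ¬e cd bd)
      go (no ¬e) (yes e) _       = ⊥-elim (mixed lt lc lb la (~-sym e) (¬e ∘ ~-sym)
        (trans (τ-sym (suc i) b a) ab) (trans (τ-sym (suc i) c a) ac))
      go _       (no ¬e) (yes e) = ⊥-elim (mixed lt ld lc lb (~-sym e) (¬e ∘ ~-sym)
        (trans (τ-sym (suc i) c b) bc) (trans (τ-sym (suc i) d b) bd))
      go (no ¬e) (no ¬e′) (no ¬e″) = P₄-step (P₄ i (<⇒≤ lt)) la lb lc ld ¬e ¬e′ ¬e″ ab bc cd ac bd
      go (yes e) (yes e′) (yes e″) = induced e e′ e″ (a ~? d) (a ≟ᶠ c) (b ≟ᶠ d)

    module _ (w N : ℕ) (small : ∀ {X} → Decidable X → CliqueBound _~_ X w → Col _~_ X N)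
             (cb : CliqueBound _~_ (λ _ → ⊤) (suc w)) where

      open Covering G w N small cb

      col-level : ∀ i → i < m → Col _~_ (Λ i) (2 ^ w)
      col-level i lt = proj₁ c , λ lx ly e → proj₂ c lx ly (lx , ly , e)
        where
        F H : Fin n → Fin n → Set
        F x y = Λ i x × Λ i y × x ~ y
        H x y = Λ i x × Λ i y × τ i x y ≡ true

        even : ∀ {x y} → Λ i x → Λ i y → ¬ H x y → τ i x y ≡ false
        even lx ly ¬h = Bool.¬-not λ t → ¬h (lx , ly , t)

        -- By `twins`, a parent of `x` is a parent of `z`; a nonadjacent odd pair shares none.
        close : ∀ i → i < m → ∀ {x y z} → Λ i x → Λ i y → Λ i z → x ~ y → y ~ z → τ i x z ≡ true → x ~ z
        close zero lt _ _ _ _ _ ()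
        close (suc i) lt lx ly lz e e′ t = decidable-stable (_ ~? _) λ ¬r →
          Step.odd-unshared i (<⇒≤ lt) lx lz (¬r , Step.τ-≢ i (<⇒≤ lt) lx t) t lp px
            (twins lt ly lz e′ lp (twins lt lx ly e lp px))
          where
          lp = proj₁ (parent-ok lx)
          px = proj₂ (parent-ok lx)

        module LC = LevelColouring F (λ x y → Λ? i x ×-dec (Λ? i y ×-dec (x ~? y))) (λ (a , b , e) → b , a , ~-sym e)
          H (λ {x} {y} (a , b , t) → b , a , trans (τ-sym i y x) t) (λ (l , _ , t) → true≢false t (τ-irr l))
          (λ (la , lb , t) (_ , lc , t′) (_ , ld , t″) ¬h ¬h′ →
            la , ld , P₄ i lt la lb lc ld t t′ t″ (even la lc ¬h) (even lb ld ¬h′))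
          (λ (a , b , e) → a , b , τ-adj a b e)
          (λ (lx , ly , e) (_ , lz , e′) (_ , _ , t) → lx , lz , close i lt lx ly lz e e′ t)

        c = LC.col-2^ w (Λ i) (Λ? i) λ K ps _ → cb K (AllPairs.map (proj₂ ∘ proj₂) ps) (All.universal (λ _ → tt) K)

      Reached : Fin n → Set
      Reached b = Floor b × ∃[ p ] (Λ m p × p ~ b)

      reached? : Decidable Reached
      reached? b = floor? b ×-dec any? λ p → Λ? m p ×-dec (p ~? b)

      level-parity : ∀ {i} {B : Fin n → Set} → (∀ {u b} → Below i u → B b → Far u b) → Parity (Λ i) B (τ i)
      level-parity {i} bf ds lp lp′ f δ bs = link-parity ohf bf (link i lp lp′ f) ds δ bs

      -- Full P₄-freeness ends at level m - 1, which `col-level` colours. For level `m` only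
      -- `P₄-step` is left, restricted to nonadjacent consecutive vertices; that is what `col-cover`
      -- asks for. Hence two coverings, from level m - 1 to `m` and from `m` to the floor.
      col-reached : ∀ i → m ≡ suc i → Col _~_ Reached ((2 ^ w * (2 ^ w * N)) * (2 ^ w * N))
      col-reached i refl = col-cover (Λ? (suc i)) reached? (τ (suc i)) (λ {x} {y} _ _ t → trans (τ-sym (suc i) y x) t) τ-irr
          proj₂ (level-parity λ u b → floor-far-below ≤-refl u (proj₁ b))
          (Step.P₄-step i ≤-refl (P₄ i ≤-refl))
          (col-cover (Λ? i) (Λ? (suc i)) (τ i) (λ {x} {y} _ _ t → trans (τ-sym i y x) t) τ-irr
            up (level-parity below-far) (λ la lb lc ld _ _ _ → P₄ i ≤-refl la lb lc ld) (col-level i ≤-refl))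

-- Minimal covers

record Sub (n : ℕ) : Set₁ where
  constructor sub
  field
    {Mem} : Fin n → Set
    mem?  : Decidable Mem

open Sub public

module Covers {n} (G : Graph n) where
  open Paths G

  HasNbr : (Fin n → Set) → Fin n → Set
  HasNbr K d = ∃[ y ] (K y × y ~ d)

  hasNbr? : ∀ {K} → Decidable K → Decidable (HasNbr K)
  hasNbr? K? d = any? λ y → K? y ×-dec (y ~? d)

  Private : (K T : Fin n → Set) → Fin n → Set
  Private K T x = ∃[ d ] (T d × x ~ d × (∀ {y} → K y → y ~ d → y ≡ x))

  record MinimalCover (K T : Sub n) : Set₁ where
    field
      cover     : Sub n
      ⊆         : ∀ {x} → Mem cover x → Mem K x
      keeps     : ∀ {d} → Mem T d → HasNbr (Mem K) d → HasNbr (Mem cover) d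
      essential : ∀ {x} → Mem cover x → Private (Mem cover) (Mem T) x

  abstract
    -- Each vertex in turn is dropped unless some target would lose its last neighbour. One pass
    -- suffices, because a private neighbour stays private when the cover shrinks.
    minimalCover : ∀ K T → MinimalCover K T
    minimalCover K T with go (allFin n)
      where
      go : (vs : List (Fin n)) → Σ[ C ∈ Sub n ] ((∀ {x} → Mem C x → Mem K x) ×
           (∀ {d} → Mem T d → HasNbr (Mem K) d → HasNbr (Mem C) d) ×
           (∀ {x} → x ∈ˡ vs → Mem C x → Private (Mem C) (Mem T) x))
      go [] = K , id , (λ _ h → h) , λ ()
      go (v ∷ vs) with go vs
      ... | C , ⊆K , keep , ess
        with any? (λ d → mem? T d ×-dec (hasNbr? (mem? C) d ×-dec ¬? (hasNbr? (λ y → mem? C y ×-dec ¬? (y ≟ᶠ v)) d)))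
      ...   | yes (d , td , (y , cy , e) , none) = C , ⊆K , keep , λ { (here refl) cx → d , td , subst (_~ d) (only cy e) e , only ; (there i) cx → ess i cx }
        where
        only : ∀ {y} → Mem C y → y ~ d → y ≡ v
        only {y} cy e with y ≟ᶠ v
        ... | yes eq = eq
        ... | no ¬eq = contradiction (y , (cy , ¬eq) , e) none
      ...   | no safe = sub (λ y → mem? C y ×-dec ¬? (y ≟ᶠ v)) , ⊆K ∘ proj₁ , keep′ , 
        λ { (here refl) (_ , x≢v) → contradiction refl x≢v ; (there i) (cx , x≢v) → shrink (ess i cx) }
        where
        keep′ : ∀ {d} → Mem T d → HasNbr (Mem K) d → HasNbr (λ y → Mem C y × y ≢ v) d
        keep′ {d} td h with hasNbr? (λ y → mem? C y ×-dec ¬? (y ≟ᶠ v)) d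
        ... | yes r = r
        ... | no ¬r = contradiction (d , td , keep td h , ¬r) safe
        shrink : ∀ {x} → Private (Mem C) (Mem T) x → Private (λ y → Mem C y × y ≢ v) (Mem T) x
        shrink (d , td , e , only) = d , td , e , only ∘ proj₁
    ... | C , ⊆K , keep , ess = record { cover = C ; ⊆ = ⊆K ; keeps = keep ; essential = λ {x} → ess (∈-allFin x) }

  -- Replace each level K i, from the last one upwards, by a minimal set covering those vertices
  -- of the next level that are not exempt.
  module Prune (m : ℕ) (K : ℕ → Sub n) (B : Sub n) {Ex : ℕ → Fin n → Set} (ex? : ∀ i → Decidable (Ex i)) where
    open MinimalCover

    -- The index counts levels upwards from `m`, since what a level must cover depends on the cover
    -- already chosen below it.
    demand : ℕ → Sub n
    layer  : ∀ t → MinimalCover (K (m ∸ t)) (demand t)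
    layer t = minimalCover (K (m ∸ t)) (demand t)
    demand zero    = B
    demand (suc t) = sub (λ x → mem? (cover (layer t)) x ×-dec ¬? (ex? (m ∸ suc t) x))

    J : ℕ → Fin n → Set
    J i x = i ≤ m × Mem (cover (layer (m ∸ i))) x

    J? : ∀ i → Decidable (J i)
    J? i x = (i ≤? m) ×-dec mem? (cover (layer (m ∸ i))) x

    J-⊆ : ∀ {i x} → J i x → Mem (K i) x
    J-⊆ {i} {x} (le , j) = subst (λ k → Mem (K k) x) (m∸[m∸n]≡n le) (⊆ (layer (m ∸ i)) j)

    next : ∀ {i} → i < m → m ∸ i ≡ suc (m ∸ suc i)
    next {i} lt = step m lt
      where
      step : ∀ {i} m → i < m → m ∸ i ≡ suc (m ∸ suc i)
      step {zero}  (suc m) _        = refl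
      step {suc i} (suc m) (s≤s lt) = step m lt

    module _ {i} (lt : i < m) where

      private
        t = m ∸ suc i
        t-level : m ∸ suc t ≡ i
        t-level = trans (cong (m ∸_) (sym (next lt))) (m∸[m∸n]≡n (<⇒≤ lt))

      J-keeps : ∀ {x} → J (suc i) x → ¬ Ex i x → HasNbr (Mem (K i)) x → HasNbr (J i) x
      J-keeps {x} (_ , j) ¬ex h with keeps (layer (suc t)) (j , λ e → ¬ex (subst (λ k → Ex k x) t-level e))
                                       (subst (λ k → HasNbr (Mem (K k)) x) (sym t-level) h)
      ... | y , jy , e = y , (<⇒≤ lt , subst (λ k → Mem (cover (layer k)) y) (sym (next lt)) jy) , e

      J-private : ∀ {x} → J i x → ∃[ c ] (J (suc i) c × ¬ Ex i c × x ~ c × (∀ {y} → J i y → y ~ c → y ≡ x))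
      J-private {x} (_ , j) with essential (layer (suc t)) (subst (λ k → Mem (cover (layer k)) x) (next lt) j)
      ... | c , (jc , ¬ex) , e , only = c , (lt , jc) , (λ ex → ¬ex (subst (λ k → Ex k c) (sym t-level) ex)) , e ,
        λ {y} jy → only (subst (λ k → Mem (cover (layer k)) y) (next lt) (proj₂ jy))

    private
      zero-level : m ∸ m ≡ 0
      zero-level = n∸n≡0 m

    J-keeps-last : ∀ {b} → Mem B b → HasNbr (Mem (K m)) b → HasNbr (J m) b
    J-keeps-last bb h with keeps (layer 0) bb h
    ... | y , jy , e = y , (≤-refl , subst (λ k → Mem (cover (layer k)) y) (sym zero-level) jy) , e

    J-private-last : ∀ {x} → J m x → ∃[ b ] (Mem B b × x ~ b × (∀ {y} → J m y → y ~ b → y ≡ x))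
    J-private-last {x} (_ , j) with essential (layer 0) (subst (λ k → Mem (cover (layer k)) x) zero-level j)
    ... | b , bb , e , only = b , bb , e , λ {y} jy → only (subst (λ k → Mem (cover (layer k)) y) zero-level (proj₂ jy))

-- Levellings with a spine

-- A levelling with a distinguished path σ 0, …, σ m that passes once through every level; the other
-- vertices of level i are W i.
record Spined {n} (G : Graph n) (m : ℕ) : Set₁ where
  open Paths G
  field
    W           : ℕ → Fin n → Set
    W?          : ∀ i → Decidable (W i)
    σ           : ℕ → Fin n
    W-bounded   : ∀ {i x} → W i x → i ≤ m
    W-zero      : ∀ {x} → ¬ W 0 x
    W-disjoint  : ∀ {i j x} → W i x → W j x → i ≡ j
    W-distant   : ∀ {i j x y} → W i x → W j y → suc i < j → ¬ x ~ y
    W-≢σ        : ∀ {i j x} → W i x → j ≤ m → x ≢ σ j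
    W-~σ        : ∀ {i j x} → W i x → j ≤ m → x ~ σ j → j ≡ i ⊎ suc j ≡ i
    W-up        : ∀ {i x} → W (suc i) x → x ~ σ i ⊎ ∃[ y ] (W i y × y ~ x)
    W-child     : ∀ {i x} → i < m → W i x → ∃[ c ] (W (suc i) c × ¬ c ~ σ i × x ~ c × (∀ {y} → W i y → y ~ c → y ≡ x))
    σ-injective : ∀ {i j} → i ≤ m → j ≤ m → σ i ≡ σ j → i ≡ j
    σ-step      : ∀ {i} → i < m → σ i ~ σ (suc i)
    σ-distant   : ∀ {i j} → suc i < j → j ≤ m → ¬ σ i ~ σ j
    Floor       : Fin n → Set
    floor?      : Decidable Floor
    connected   : ∀ {a b} → Floor a → Floor b → Star (Edge Floor) a b
    W-floor     : ∀ {i x b} → W i x → i < m → Floor b → Far x b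
    σ-floor     : ∀ {i b} → i < m → Floor b → Far (σ i) b
    W-bottom    : ∀ {x} → W m x → ∃[ b ] (Floor b × x ~ b)
    σ-bottom    : ∃[ b ] (Floor b × σ m ~ b)

module Spine {n} {G : Graph n} {m} (S : Spined G m) (ohf : Paths.OddHoleFree G) where
  open Paths G
  open Spined S

  levelling : Levelling G
  levelling = record
    { Λ        = λ i x → W i x ⊎ (i ≤ m × x ≡ σ i)
    ; Λ?       = λ i x → W? i x ⊎-dec ((i ≤? m) ×-dec (x ≟ᶠ σ i))
    ; disjoint = disj
    ; distant  = dist
    ; apex     = λ { (inj₂ (_ , refl)) (inj₂ (_ , refl)) → refl
                   ; (inj₁ w) _ → contradiction w W-zero ; _ (inj₁ w) → contradiction w W-zero }
    ; up       = ups
    }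
    where
    disj : ∀ {i j x} → W i x ⊎ (i ≤ m × x ≡ σ i) → W j x ⊎ (j ≤ m × x ≡ σ j) → i ≡ j
    disj (inj₁ w) (inj₁ w′) = W-disjoint w w′
    disj (inj₁ w) (inj₂ (le , e)) = contradiction e (W-≢σ w le)
    disj (inj₂ (le , e)) (inj₁ w) = contradiction e (W-≢σ w le)
    disj (inj₂ (le , e)) (inj₂ (le′ , e′)) = σ-injective le le′ (trans (sym e) e′)

    dist : ∀ {i j x y} → W i x ⊎ (i ≤ m × x ≡ σ i) → W j y ⊎ (j ≤ m × y ≡ σ j) → suc i < j → ¬ x ~ y
    dist (inj₁ w) (inj₁ w′) lt = W-distant w w′ lt
    dist (inj₁ w) (inj₂ (le , refl)) lt e with W-~σ w le e
    ... | inj₁ refl = <-irrefl refl (<⇒≤ lt)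
    ... | inj₂ refl = <-irrefl refl (≤-trans (<⇒≤ lt) (n≤1+n _))
    dist (inj₂ (le , refl)) (inj₁ w) lt e with W-~σ w le (~-sym e)
    ... | inj₁ refl = <-irrefl refl (<⇒≤ lt)
    ... | inj₂ refl = <-irrefl refl lt
    dist (inj₂ (le , refl)) (inj₂ (le′ , refl)) lt = σ-distant lt le′

    ups : ∀ {i x} → W (suc i) x ⊎ (suc i ≤ m × x ≡ σ (suc i)) → ∃[ y ] ((W i y ⊎ (i ≤ m × y ≡ σ i)) × y ~ x)
    ups (inj₂ (lt , refl)) = _ , inj₂ (<⇒≤ lt , refl) , σ-step lt
    ups (inj₁ w) with W-up w
    ... | inj₁ e = _ , inj₂ (<⇒≤ (W-bounded w) , refl) , ~-sym e
    ... | inj₂ (y , wy , e) = y , inj₁ wy , e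

  grounded : Grounded levelling m
  grounded = record
    { Floor = Floor ; floor? = floor? ; connected = connected
    ; floor-far = λ { (inj₁ w) lt f → W-floor w lt f ; (inj₂ (_ , refl)) lt f → σ-floor lt f }
    ; bottom = λ { (inj₁ w) → W-bottom w ; (inj₂ (_ , refl)) → σ-bottom }
    ; child = children
    }
    where
    children : ∀ {i x} → i < m → W i x ⊎ (i ≤ m × x ≡ σ i) →
               ∃[ c ] ((W (suc i) c ⊎ (suc i ≤ m × c ≡ σ (suc i))) × x ~ c ×
                       (∀ {y} → W i y ⊎ (i ≤ m × y ≡ σ i) → y ~ c → y ≡ x))
    children lt (inj₁ w) with W-child lt w
    ... | c , wc , ¬s , e , only = c , inj₁ wc , e ,
      λ { (inj₁ wy) e′ → only wy e′ ; (inj₂ (_ , refl)) e′ → contradiction (~-sym e′) ¬s }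
    children lt (inj₂ (le , refl)) = _ , inj₂ (lt , refl) , σ-step lt , 
      λ { (inj₂ (_ , refl)) _ → refl ; (inj₁ wy) e → ⊥-elim (absurd (W-~σ wy lt e)) }
      where
      absurd : ∀ {i} → suc i ≡ i ⊎ suc (suc i) ≡ i → ⊥
      absurd (inj₁ ())
      absurd (inj₂ ())

  open Ground levelling grounded ohf hiding (connected; floor?; Floor)

  σ-level : ∀ {i} → i ≤ m → Λ i (σ i)
  σ-level le = inj₂ (le , refl)

  W-σ-next : ∀ {i x} → suc i ≤ m → W i x → ¬ x ~ σ (suc i)
  W-σ-next lt w e with W-~σ w lt e
  ... | inj₁ ()
  ... | inj₂ ()

  -- The induced path y, p, …, σ i, σ (suc i) obtained from a link between p and σ i.
  via-spine : ∀ {i y p π} → suc i ≤ m → W (suc i) y → ¬ y ~ σ i → ¬ y ~ σ (suc i) → W i p → p ~ y → Link i p (σ i) π →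
              ∃[ qs ] (Path y qs (σ (suc i)) × odd qs ≡ not π ×
                       (∀ {Q : Fin n → Set} → Q p → Q (σ i) → (∀ {u} → Below i u → Q u) → All Q qs))
  via-spine {i} {y} {p} lt wy y≁s y≁s′ wp e l with link-path l
  ... | ps , ρ , o , b = p ∷ (ps ∷ʳ σ i) ,
    (~-sym e , ++⁺ (All.map (λ u → Far-sym (below-far u (inj₁ wy))) b) ((y≁s , W-≢σ wy (<⇒≤ lt)) ∷ []) ,
      (y≁s′ , W-≢σ wy lt) ,
      snoc ps ρ (σ-step lt) (All.map (λ u → Far-sym (below-far u (σ-level lt))) b)
        (Far-sym (W-σ-next lt wp , W-≢σ wp lt))) ,
    trans (cong not (odd-∷ʳ ps)) (trans (Bool.not-involutive _) o) ,
    λ qp qs qb → qp ∷ ++⁺ (All.map qb b) (qs ∷ [])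

  -- If p is adjacent to y but not to x, where x ~ y, then going to the spine via y and p yields an induced
  -- path from x of the wrong parity.
  module Even (even : ∀ {i x} → i < m → W i x → ¬ x ~ σ i) where

    -- The link ends at a shared spine parent, with length two, and each climb adds two.
    spine-even : ∀ i {x} → i < m → W i x → Link i x (σ i) false
    spine-even zero    lt w = contradiction w W-zero
    spine-even (suc i) {x} lt w with x ~? σ i
    ... | yes e = share (inj₁ w) (σ-level (<⇒≤ lt)) (even lt w , W-≢σ w (<⇒≤ lt)) (σ-level (<⇒≤ (<⇒≤ lt))) (~-sym e) (σ-step (<⇒≤ lt))
    ... | no ¬e with W-up w
    ...   | inj₁ e = contradiction e ¬e
    ...   | inj₂ (y , wy , e) = climb (inj₁ w) (σ-level (<⇒≤ lt)) (even lt w , W-≢σ w (<⇒≤ lt))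
      (inj₁ wy) (σ-level (<⇒≤ (<⇒≤ lt))) e (σ-step (<⇒≤ lt)) (W-σ-next (<⇒≤ lt) wy) (¬e ∘ ~-sym) (spine-even i (<⇒≤ lt) wy)

    module _ {i} (lt : suc i < m) where

      private
        s s′ : Fin n
        s  = σ i
        s′ = σ (suc i)
        lt₁ = <⇒≤ lt
        lt₂ = <⇒≤ lt₁
        far-s′ : ∀ {x} → W (suc i) x → Far x s′
        far-s′ w = even lt w , W-≢σ w lt₁

      -- Otherwise `x`, `y`, `s`, `s′` is an induced path of length three, against `spine-even`.
      spine-nbrs : ∀ {x y} → W (suc i) x → W (suc i) y → x ~ y → y ~ s → x ~ s
      spine-nbrs {x} {y} wx wy e ys with x ~? s
      ... | yes r = r
      ... | no ¬r = contradiction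
        (link-vs-path lt (inj₁ wx) (σ-level lt₁) (spine-even (suc i) lt wx) (y ∷ s ∷ [])
          (e , (¬r , W-≢σ wx lt₂) ∷ [] , far-s′ wx , ys , [] , far-s′ wy , σ-step lt₁)
          (inj₂ (inj₁ wy , ~⇒≢ (~-sym e) , W-≢σ wy lt₁) ∷ inj₁ (i , n<1+n i , σ-level lt₂) ∷ []))
        λ ()

      no-distinguished : ∀ {x y p} → W (suc i) x → W (suc i) y → x ~ y → Λ i p → p ~ y → ¬ ¬ p ~ x
      no-distinguished {x} {y} {p} wx wy e lp py ¬px with x ~? s | y ~? s
      ... | no ¬xs | yes ys = ¬xs (spine-nbrs wx wy e ys)
      ... | yes xs | no ¬ys = ¬ys (spine-nbrs wy wx (~-sym e) xs)
      no-distinguished {x} {y} {p} wx wy e (inj₂ (_ , refl)) py ¬px | no _ | no ¬ys = ¬ys (~-sym py)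
      no-distinguished {x} {y} {p} wx wy e (inj₁ wp) py ¬px | no ¬xs | no ¬ys
        with via-spine lt₁ wy ¬ys (even lt wy) wp py (spine-even i lt₁ wp)
      ... | qs , ρ , o , at = contradiction
        (trans (cong not (sym o))
          (link-vs-path lt (inj₁ wx) (σ-level lt₁) (spine-even (suc i) lt wx) (y ∷ qs)
            (e , at (¬px ∘ ~-sym , level-≢ (inj₁ wp) (inj₁ wx) ∘ sym) (¬xs , W-≢σ wx lt₂)
                   (λ b → Far-sym (below-far b (inj₁ wx))) , far-s′ wx , ρ)
            (inj₂ (inj₁ wy , ~⇒≢ (~-sym e) , W-≢σ wy lt₁) ∷
              at (inj₁ (i , n<1+n i , inj₁ wp)) (inj₁ (i , n<1+n i , σ-level lt₂))
                 (λ (j , l , lj) → inj₁ (j , ≤-trans l (n≤1+n i) , lj)))))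
        λ ()
      no-distinguished {x} {y} {p} wx wy e (inj₂ (_ , refl)) py ¬px | yes xs | yes _ = ¬px (~-sym xs)
      -- Both ends see the spine, so the comparison starts one step aside, at the private child `c`
      -- of `p`. As `c` misses `s`, `spine-nbrs` keeps it away from `x` and `y`: the path `c`, `p`,
      -- `y`, `x` has length three, while the link through `p` and `s` is even.
      no-distinguished {x} {y} {p} wx wy e (inj₁ wp) py ¬px | yes xs | yes ys with W-child lt₁ wp
      ... | c , wc , ¬cs , pc , _ = contradiction
        (link-vs-path lt (inj₁ wc) (inj₁ wx)
          (climb (inj₁ wc) (inj₁ wx) fcx (inj₁ wp) (σ-level lt₂) pc (~-sym xs) ¬px (¬cs ∘ ~-sym) (spine-even i lt₁ wp))
          (p ∷ y ∷ [])
          (~-sym pc , fcy ∷ [] , fcx , py , [] , (¬px , level-≢ (inj₁ wp) (inj₁ wx)) , ~-sym e)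
          (inj₁ (i , n<1+n i , inj₁ wp) ∷ inj₂ (inj₁ wy , proj₂ fcy ∘ sym , ~⇒≢ (~-sym e)) ∷ []))
        λ ()
        where
        far-c : ∀ {z} → W (suc i) z → z ~ s → Far c z
        far-c wz zs = (λ r → ¬cs (spine-nbrs wc wz r zs)) , λ { refl → ¬cs zs }
        fcx = far-c wx xs
        fcy = far-c wy ys

    twins : Twins
    twins lt (inj₂ (_ , refl)) (inj₂ (_ , refl)) e lp px = contradiction e ~-irr
    twins lt (inj₂ (_ , refl)) (inj₁ wy) e lp px = contradiction (~-sym e) (even lt wy)
    twins lt (inj₁ wx) (inj₂ (_ , refl)) e lp px = contradiction e (even lt wx)
    twins lt (inj₁ wx) (inj₁ wy) e lp px = decidable-stable (_ ~? _) (no-distinguished lt wy wx (~-sym e) lp px)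

  -- Spines seen at two consecutive vertices or at none

  module Odd (both₁ : ∀ {i x} → suc i < m → W (suc i) x → x ~ σ i → x ~ σ (suc i))
             (both₂ : ∀ {i x} → suc i < m → W (suc i) x → x ~ σ (suc i) → x ~ σ i)
             (sparse : ∀ {i x y} → suc i < m → W (suc i) x → x ~ σ (suc i) → W i y → ¬ y ~ σ i) where

    -- A parent that sees the spine gives a `cross`, of length three, and each climb adds two;
    -- `both₁` rules out a shared spine parent.
    spine-odd : ∀ i {x} → i < m → W i x → ¬ x ~ σ i → Link i x (σ i) true
    spine-odd zero    lt w _ = contradiction w W-zero
    spine-odd (suc i) {x} lt w ¬e with W-up w
    ... | inj₁ e = contradiction (both₁ lt w e) ¬e
    ... | inj₂ (y , wy , e) with y ~? σ i
    ...   | yes r = cross (inj₁ w) (σ-level (<⇒≤ lt)) (¬e , W-≢σ w (<⇒≤ lt)) (inj₁ wy) (σ-level (<⇒≤ (<⇒≤ lt))) e (σ-step (<⇒≤ lt))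
      (W-σ-next (<⇒≤ lt) wy) (¬e ∘ both₁ lt w ∘ ~-sym) r
    ...   | no ¬r = climb (inj₁ w) (σ-level (<⇒≤ lt)) (¬e , W-≢σ w (<⇒≤ lt)) (inj₁ wy) (σ-level (<⇒≤ (<⇒≤ lt))) e (σ-step (<⇒≤ lt))
      (W-σ-next (<⇒≤ lt) wy) (¬e ∘ both₁ lt w ∘ ~-sym) (spine-odd i (<⇒≤ lt) wy ¬r)

    module _ {i} (lt : suc i < m) where

      private
        s s′ : Fin n
        s  = σ i
        s′ = σ (suc i)
        lt₁ = <⇒≤ lt
        lt₂ = <⇒≤ lt₁

      -- By `sparse`, `p` has an odd link to `s`; as `t` sees both `p` and `s`, it would close that
      -- path to an odd hole.
      pure : ∀ {t p} → W (suc i) t → t ~ s′ → W i p → ¬ p ~ t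
      pure {t} {p} wt ts′ wp e with link-path (spine-odd i lt₁ wp (sparse lt wt ts′ wp))
      ... | [] , ρ , _ = sparse lt wt ts′ wp ρ
      ... | q ∷ qs , ρ , o , b = ohf (q ∷ qs) ρ (~-sym e) (both₂ lt wt ts′)
        (All.map (λ u → Far-sym (below-far u (inj₁ wt))) b) o λ ()

      -- The path `x`, `y`, `s′` would have length two, against `spine-odd`.
      bridge : ∀ {x y} → W (suc i) x → W (suc i) y → ¬ x ~ s′ → y ~ s′ → ¬ x ~ y
      bridge {x} {y} wx wy ¬xs ys e = contradiction
        (link-vs-path lt (inj₁ wx) (σ-level lt₁) (spine-odd (suc i) lt wx ¬xs) [ y ]
          (e , [] , (¬xs , W-≢σ wx lt₁) , ys) (inj₂ (inj₁ wy , ~⇒≢ (~-sym e) , W-≢σ wy lt₁) ∷ []))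
        λ ()

      detour : ∀ {y p} → W (suc i) y → ¬ y ~ s′ → W i p → p ~ y →
               ∃[ qs ] (Path y qs s′ × odd qs ≡ false ×
                        (∀ {Q : Fin n → Set} → Q p → Q s → (∀ {u} → Below i u → Q u) → All Q qs))
      detour {y} {p} wy ¬ys wp py with p ~? s
      ... | no ¬ps = via-spine lt₁ wy (¬ys ∘ both₁ lt wy) ¬ys wp py (spine-odd i lt₁ wp ¬ps)
      -- No link joins adjacent vertices, so the path `y`, `p`, `s`, `s′` of length three is written
      -- out.
      ... | yes ps = p ∷ s ∷ [] ,
        (~-sym py , ((¬ys ∘ both₁ lt wy) , W-≢σ wy lt₂) ∷ [] , (¬ys , W-≢σ wy lt₁) ,
          ps , [] , (W-σ-next lt₁ wp , W-≢σ wp lt₁) , σ-step lt₁) ,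
        refl , λ qp qs _ → qp ∷ qs ∷ []

      no-distinguished : ∀ {x y p} → W (suc i) x → W (suc i) y → x ~ y → Λ i p → p ~ y → ¬ ¬ p ~ x
      no-distinguished {x} {y} {p} wx wy e lp py ¬px with x ~? s′ | y ~? s′
      ... | no ¬xs | yes ys = bridge wx wy ¬xs ys e
      ... | yes xs | no ¬ys = bridge wy wx ¬ys xs (~-sym e)
      no-distinguished {x} {y} {p} wx wy e (inj₁ wp) py ¬px | yes xs | yes ys = pure wy ys wp py
      no-distinguished {x} {y} {p} wx wy e (inj₂ (_ , refl)) py ¬px | yes xs | yes ys = ¬px (~-sym (both₂ lt wx xs))
      no-distinguished {x} {y} {p} wx wy e (inj₂ (_ , refl)) py ¬px | no ¬xs | no ¬ys = ¬ys (both₁ lt wy (~-sym py))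
      no-distinguished {x} {y} {p} wx wy e (inj₁ wp) py ¬px | no ¬xs | no ¬ys with detour wy ¬ys wp py
      ... | qs , ρ , o , at = contradiction
        (trans (cong not (sym o))
          (link-vs-path lt (inj₁ wx) (σ-level lt₁) (spine-odd (suc i) lt wx ¬xs) (y ∷ qs)
            (e , at (¬px ∘ ~-sym , level-≢ (inj₁ wp) (inj₁ wx) ∘ sym) (¬xs ∘ both₁ lt wx , W-≢σ wx lt₂)
                   (λ b → Far-sym (below-far b (inj₁ wx))) , (¬xs , W-≢σ wx lt₁) , ρ)
            (inj₂ (inj₁ wy , ~⇒≢ (~-sym e) , W-≢σ wy lt₁) ∷
              at (inj₁ (i , n<1+n i , inj₁ wp)) (inj₁ (i , n<1+n i , σ-level lt₂))
                 (λ (j , l , lj) → inj₁ (j , ≤-trans l (n≤1+n i) , lj)))))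
        λ ()

    twins : Twins
    twins lt (inj₂ (_ , refl)) (inj₂ (_ , refl)) e lp px = contradiction e ~-irr
    twins lt (inj₂ (_ , refl)) (inj₁ wy) e (inj₁ wp) px = contradiction px (W-σ-next (<⇒≤ lt) wp)
    twins lt (inj₂ (_ , refl)) (inj₁ wy) e (inj₂ (_ , refl)) px = ~-sym (both₂ lt wy (~-sym e))
    twins lt (inj₁ wx) (inj₂ (_ , refl)) e (inj₁ wp) px = ⊥-elim (pure lt wx e wp px)
    twins lt (inj₁ wx) (inj₂ (_ , refl)) e (inj₂ (_ , refl)) px = σ-step (<⇒≤ lt)
    twins lt (inj₁ wx) (inj₁ wy) e lp px = decidable-stable (_ ~? _) (no-distinguished lt wy wx (~-sym e) lp px)

zero-or-one : (p : Fin 2) → p ≡ zero ⊎ p ≡ suc zero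
zero-or-one zero       = inj₁ refl
zero-or-one (suc zero) = inj₂ refl

-- Colouring one component of a breadth-first level

abstract
  extend : ∀ {A : Set} → ℕ → (ℕ → A) → A → ℕ → A
  extend m f v j with j ≤? m
  ... | yes _ = f j
  ... | no  _ = v

  extend-≤ : ∀ {A : Set} m (f : ℕ → A) v {j} → j ≤ m → extend m f v j ≡ f j
  extend-≤ m f v {j} le with j ≤? m
  ... | yes _  = refl
  ... | no ¬le = contradiction le ¬le

  extend-last : ∀ {A : Set} m (f : ℕ → A) v → extend m f v (suc m) ≡ v
  extend-last m f v with suc m ≤? m
  ... | yes le = contradiction le (<-irrefl refl)
  ... | no  _  = refl

extend-all : ∀ {A : Set} {P : ℕ → A → Set} m (f : ℕ → A) v → (∀ {j} → j ≤ m → P j (f j)) → P (suc m) v →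
             ∀ {j} → j ≤ suc m → P j (extend m f v j)
extend-all {P = P} m f v p q le with m≤n⇒m<n∨m≡n le
... | inj₁ lt   = subst (P _) (sym (extend-≤ m f v (≤-pred lt))) (p (≤-pred lt))
... | inj₂ refl = subst (P _) (sym (extend-last m f v)) q

extend-step : ∀ {A : Set} {R : A → A → Set} m (f : ℕ → A) v → (∀ {j} → j < m → R (f j) (f (suc j))) → R (f m) v →
              ∀ {j} → j ≤ m → R (extend m f v j) (extend m f v (suc j))
extend-step {R = R} m f v p q le with m≤n⇒m<n∨m≡n le
... | inj₁ lt   = subst₂ R (sym (extend-≤ m f v le)) (sym (extend-≤ m f v lt)) (p lt)
... | inj₂ refl = subst₂ R (sym (extend-≤ m f v le)) (sym (extend-last m f v)) q

module LevelBound {n} (G : Graph n) (ohf : Paths.OddHoleFree G) (w N : ℕ)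
  (small : ∀ {X} → Decidable X → CliqueBound (Adj G) X w → Col (Adj G) X N)
  (cb : CliqueBound (Adj G) (λ _ → ⊤) (suc w)) where

  open Paths G

  Y : ℕ
  Y = (2 ^ w * (2 ^ w * N)) * (2 ^ w * N)

  col-nbrs : ∀ {X} a → Decidable X → (∀ {x} → X x → a ~ x) → Col _~_ X N
  col-nbrs a X? adj = small X? λ K ps xs →
    s≤s⁻¹ (cb (a ∷ K) (All.map adj xs ∷ ps) (All.universal (λ _ → tt) _))

  Reached : ∀ {m} → Spined G m → Fin n → Set
  Reached {m} S b = Floor b × ∃[ p ] (W m p × p ~ b)
    where open Spined S

  col-even : ∀ {k} (S : Spined G (suc k)) → (∀ {i x} → i < suc k → Spined.W S i x → ¬ x ~ Spined.σ S i) →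
             Col _~_ (Reached S) Y
  col-even {k} S even = col-⊆ (λ (f , p , w , e) → f , p , inj₁ w , e)
    (Ground.WithTwins.col-reached _ (Spine.grounded S ohf) ohf (Spine.Even.twins S ohf even) w N small cb k refl)

  col-odd : ∀ {k} (S : Spined G (suc k)) (let open Spined S using (W; σ)) →
            (∀ {i x} → W (suc i) x → x ~ σ i → x ~ σ (suc i)) → (∀ {i x} → W (suc i) x → x ~ σ (suc i) → x ~ σ i) →
            (∀ {i x y} → W (suc i) x → x ~ σ (suc i) → W i y → ¬ y ~ σ i) → Col _~_ (Reached S) Y
  col-odd {k} S both₁ both₂ sparse = col-⊆ (λ (f , p , w , e) → f , p , inj₁ w , e)
    (Ground.WithTwins.col-reached _ (Spine.grounded S ohf) ohf
      (Spine.Odd.twins S ohf (λ _ → both₁) (λ _ → both₂) (λ _ → sparse)) w N small cb k refl)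

  module Below (z : Fin n) (m′ : ℕ) (c₀ : Fin n)
    (c₀-level : BFS.Level _~_ _~?_ ~-sym (λ _ → ⊤) (λ _ → yes tt) z (suc (suc m′)) c₀) where

    module B = BFS _~_ _~?_ ~-sym (λ _ → ⊤) (λ _ → yes tt) z

    m : ℕ
    m = suc m′

    open B using (Level; level?)

    level-far : ∀ {i j x y} → Level i x → Level j y → suc i < j → Far x y
    level-far lx ly lt =
      (λ e → <-irrefl refl (≤-trans lt (B.level-≤ lx ly e))) ,
      λ { refl → <-irrefl (trans (sym (proj₂ lx)) (proj₂ ly)) (<⇒≤ lt) }

    level-≢ : ∀ {i j x y} → Level i x → Level j y → i ≢ j → x ≢ y
    level-≢ lx ly i≢j refl = i≢j (trans (sym (proj₂ lx)) (proj₂ ly))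

    module C = BFS _~_ _~?_ ~-sym (Level (suc m)) (level? (suc m)) c₀

    c-level : ∀ {x} → C.Comp x → Level (suc m) x
    c-level = C.comp-⊆ c₀-level

    open Covers G
    module P₁ = Prune m (λ i → sub (level? i)) (sub C.comp?) {Ex = λ _ _ → ⊥} (λ _ _ → no id)
    open P₁ using (J; J?)

    has-parent : ∀ {i x} → Level (suc i) x → HasNbr (Level i) x
    has-parent = B.level-parent

    J-level : ∀ {i x} → J i x → Level i x
    J-level = P₁.J-⊆

    J-up : ∀ {i x} → J (suc i) x → HasNbr (J i) x
    J-up j = P₁.J-keeps (proj₁ j) j id (has-parent (J-level j))

    J-zero : J 0 z
    J-zero with P₁.J-keeps-last C.comp-root (has-parent c₀-level)
    ... | y , jy , _ = go m jy
      where
      go : ∀ i {x} → J i x → J 0 z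
      go zero    j = subst (J 0) (B.level-zero (J-level j)) j
      go (suc i) j = go i (proj₁ (proj₂ (J-up j)))

    -- Uniqueness concerns the parent of `c`; `x` may have other children.
    OnlyChild : ℕ → Fin n → Fin n → Set
    OnlyChild i x c = J (suc i) c × x ~ c × (∀ y → J i y → y ~ c → y ≡ x)

    onlyChild? : ∀ i x → Decidable (OnlyChild i x)
    onlyChild? i x c = J? (suc i) c ×-dec ((x ~? c) ×-dec all? λ y → J? i y →-dec ((y ~? c) →-dec (y ≟ᶠ x)))

    abstract
      s : ℕ → Fin n
      s zero    = z
      s (suc i) = find (onlyChild? i (s i)) (s i)

      s-zero : s 0 ≡ z
      s-zero = refl

      s-J    : ∀ {i} → i ≤ m → J i (s i)
      s-next : ∀ {i} → i < m → OnlyChild i (s i) (s (suc i))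
      s-J {zero}  _  = J-zero
      s-J {suc i} lt = proj₁ (s-next lt)
      s-next {i} lt = proj₁ (find-least (onlyChild? i (s i)) (s i)
        (proj₁ c , proj₁ (proj₂ c) , proj₁ (proj₂ (proj₂ (proj₂ c))) , λ y → proj₂ (proj₂ (proj₂ (proj₂ c)))))
        where
        c : ∃[ c ] (J (suc i) c × ¬ ⊥ × s i ~ c × (∀ {y} → J i y → y ~ c → y ≡ s i))
        c = P₁.J-private lt (s-J (<⇒≤ lt))

    a : Fin n
    a = s m

    s-level : ∀ {i} → i ≤ m → Level i (s i)
    s-level = J-level ∘ s-J

    J-~s : ∀ {i j x} → J i x → x ≢ s i → j ≤ m → x ~ s j → j ≡ i ⊎ suc j ≡ i
    J-~s {i} {j} jx x≢s le e with <-cmp i j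
    ... | tri≈ _ i≡j _ = inj₁ (sym i≡j)
    ... | tri> _ _ j<i = inj₂ (≤-antisym j<i (B.level-≤ (s-level le) (J-level jx) (~-sym e)))
    ... | tri< i<j _ _ with ≤-antisym i<j (B.level-≤ (J-level jx) (s-level le) e)
    ...   | refl = contradiction (proj₂ (proj₂ (s-next le)) _ jx e) x≢s

    -- In the shifted spine `a` is the last vertex but one and must be far from the floor, so its
    -- neighbours are coloured separately.
    X′ : Fin n → Set
    X′ x = C.Comp x × ¬ a ~ x

    X′? : Decidable X′
    X′? x = C.comp? x ×-dec ¬? (a ~? x)

    module Part (d₀ : Fin n) (d₀-in : X′ d₀) where

      module D = BFS _~_ _~?_ ~-sym X′ X′? d₀

      d-in : ∀ {x} → D.Comp x → X′ x
      d-in = D.comp-⊆ d₀-in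

      d-level : ∀ {x} → D.Comp x → Level (suc m) x
      d-level = c-level ∘ proj₁ ∘ d-in

      -- The component contains a neighbour of `a`, so a walk to it from `d₀` leaves the part
      -- through some neighbour `v` of `a`. This `v` joins the end of the spine to the part.
      door : ∃[ v ] ∃[ d ] (D.Comp d × C.Comp v × a ~ v × v ~ d)
      door = first-exit (a ~?_) (λ dx e cy ¬ay → D.comp-closed dx e (cy , ¬ay)) (proj₂ ∘ d-in) D.comp-root
        (reverse-walk C.comp-root (C.reach (proj₁ (d-in D.comp-root))) ◅◅ C.reach (proj₁ (proj₂ a-child)))
        (proj₁ (proj₂ (proj₂ a-child)))
        where
        a-child : ∃[ b ] (C.Comp b × a ~ b × (∀ {y} → J m y → y ~ b → y ≡ a))
        a-child = P₁.J-private-last (s-J ≤-refl)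

      v d₁ : Fin n
      v  = proj₁ door
      d₁ = proj₁ (proj₂ door)
      d₁-in : D.Comp d₁
      d₁-in = proj₁ (proj₂ (proj₂ door))
      v-in : C.Comp v
      v-in = proj₁ (proj₂ (proj₂ (proj₂ door)))
      a~v : a ~ v
      a~v = proj₁ (proj₂ (proj₂ (proj₂ (proj₂ door))))
      v~d₁ : v ~ d₁
      v~d₁ = proj₂ (proj₂ (proj₂ (proj₂ (proj₂ door))))

      d-connected : ∀ {x y} → D.Comp x → D.Comp y → Star (Edge D.Comp) x y
      d-connected dx dy = reverse-walk D.comp-root (D.reach dx) ◅◅ D.reach dy

      -- The spine neighbours of a vertex of level suc i are among s i and s (suc i), because s i is the only
      -- parent of s (suc i). A kind fixes which of them occur at the first vertex of an upward path that
      -- sees the spine.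
      record Kind : Set₁ where
        field
          Hit Pass : ℕ → Fin n → Set
          hit?     : ∀ i → Decidable (Hit i)
          pass?    : ∀ i → Decidable (Pass i)
          hit-≢    : ∀ {i x} → Hit i x → x ≢ s (suc i)
          pass-≢   : ∀ {i x} → Pass i x → x ≢ s (suc i)

      module Class (K : Kind) where
        open Kind K

        V : ℕ → Fin n → Set
        V zero    x = ⊥
        V (suc i) x = J (suc i) x × (Hit i x ⊎ (Pass i x × HasNbr (V i) x))

        V? : ∀ i → Decidable (V i)
        V? zero    x = no id
        V? (suc i) x = J? (suc i) x ×-dec (hit? i x ⊎-dec (pass? i x ×-dec hasNbr? (V? i) x))

        V-J : ∀ {i x} → V i x → J i x
        V-J {suc i} = proj₁

        V-≢ : ∀ {i x} → V i x → x ≢ s i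
        V-≢ {suc i} (_ , inj₁ h)       = hit-≢ h
        V-≢ {suc i} (_ , inj₂ (p , _)) = pass-≢ p

        Caught : Fin n → Set
        Caught d = D.Comp d × HasNbr (V m) d

        caught? : Decidable Caught
        caught? d = D.comp? d ×-dec hasNbr? (V? m) d

        -- The spine σ is s or a shift of it; level-σ gives its positions in the original levels.
        record Placement : Set₁ where
          field
            σ         : ℕ → Fin n
            level-σ   : ℕ → ℕ
            σ-level   : ∀ {i} → i ≤ m → Level (level-σ i) (σ i)
            shift     : ∀ {i j} → level-σ i ≡ level-σ j → i ≡ j
            shift-<   : ∀ {i j} → suc i < j → suc (level-σ i) < level-σ j
            hit-σ     : ∀ {i x} → J (suc i) x → Hit i x → x ~ σ i
            V-≢σ      : ∀ {i j x} → V i x → j ≤ m → x ≢ σ j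
            V-~σ      : ∀ {i j x} → V i x → j ≤ m → x ~ σ j → j ≡ i ⊎ suc j ≡ i
            σ-step    : ∀ {i} → i < m → σ i ~ σ (suc i)
            Floor     : Fin n → Set
            floor?    : Decidable Floor
            connected : ∀ {a b} → Floor a → Floor b → Star (Edge Floor) a b
            D⊆Floor   : ∀ {d} → D.Comp d → Floor d
            Floor⊆C   : ∀ {b} → Floor b → C.Comp b
            σ-floor   : ∀ {i b} → i < m → Floor b → Far (σ i) b
            σ-bottom  : ∃[ b ] (Floor b × σ m ~ b)

        module Build (Pl : Placement) where
          open Placement Pl

          -- Vertices seeing `σ i` already have a spine parent and are exempt from being covered;
          -- hence the private children found here miss the spine vertex of their parent's level.
          module P₂ = Prune m (λ i → sub (V? i)) (sub D.comp?) {Ex = λ i x → x ~ σ i} (λ i x → x ~? σ i)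

          W-V : ∀ {i x} → P₂.J i x → V i x
          W-V = P₂.J-⊆

          W-level : ∀ {i x} → P₂.J i x → Level i x
          W-level = J-level ∘ V-J ∘ W-V

          W-up : ∀ {i x} → P₂.J (suc i) x → x ~ σ i ⊎ HasNbr (P₂.J i) x
          W-up {i} {x} w with x ~? σ i
          ... | yes e = inj₁ e
          ... | no ¬e = split (W-V w)
            where
            split : V (suc i) x → x ~ σ i ⊎ HasNbr (P₂.J i) x
            split (jx , inj₁ h)        = inj₁ (hit-σ jx h)
            split (_  , inj₂ (_ , nb)) = inj₂ (P₂.J-keeps (proj₁ w) w ¬e nb)

          spined : Spined G m
          spined = record
            { W = P₂.J ; W? = P₂.J? ; σ = σ
            ; W-bounded = proj₁
            ; W-zero = W-V
            ; W-disjoint = λ x y → trans (sym (proj₂ (W-level x))) (proj₂ (W-level y))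
            ; W-distant = λ x y lt → proj₁ (level-far (W-level x) (W-level y) lt)
            ; W-≢σ = V-≢σ ∘ W-V
            ; W-~σ = V-~σ ∘ W-V
            ; W-up = W-up
            ; W-child = λ lt w → P₂.J-private lt w
            ; σ-injective = λ le le′ e → shift (trans (sym (proj₂ (σ-level le))) (trans (cong B.dist e) (proj₂ (σ-level le′))))
            ; σ-step = σ-step
            ; σ-distant = λ lt le → proj₁ (level-far (σ-level (≤-trans (<⇒≤ (<⇒≤ lt)) le)) (σ-level le) (shift-< lt))
            ; Floor = Floor ; floor? = floor? ; connected = connected
            ; W-floor = λ w lt f → level-far (W-level w) (c-level (Floor⊆C f)) (s≤s lt)
            ; σ-floor = σ-floor
            ; W-bottom = λ w → let b , db , e , _ = P₂.J-private-last w in b , D⊆Floor db , e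
            ; σ-bottom = σ-bottom
            }

          caught⊆reached : ∀ {d} → Caught d → Reached spined d
          caught⊆reached (dd , nb) = D⊆Floor dd , P₂.J-keeps-last dd nb

        col-caught-even : (Pl : Placement) (let open Placement Pl) → (∀ {i x} → i < m → V i x → ¬ x ~ σ i) → Col _~_ Caught Y
        col-caught-even Pl even = col-⊆ (Build.caught⊆reached Pl)
          (col-even (Build.spined Pl) λ lt w → even lt (Build.W-V Pl w))

        col-caught-odd : (Pl : Placement) (let open Placement Pl) →
          (∀ {i x} → V (suc i) x → x ~ σ i → x ~ σ (suc i)) → (∀ {i x} → V (suc i) x → x ~ σ (suc i) → x ~ σ i) →
          (∀ {i x y} → V (suc i) x → x ~ σ (suc i) → V i y → ¬ y ~ σ i) → Col _~_ Caught Y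
        col-caught-odd Pl both₁ both₂ sparse = col-⊆ (Build.caught⊆reached Pl)
          (col-odd (Build.spined Pl) (both₁ ∘ Build.W-V Pl) (both₂ ∘ Build.W-V Pl)
            λ w e w′ → sparse (Build.W-V Pl w) e (Build.W-V Pl w′))

      -- The last spine vertex `a` has no neighbour in the part, so `v` is added to give it one on
      -- the floor.
      DoorFloor : Fin n → Set
      DoorFloor b = D.Comp b ⊎ b ≡ v

      to-door : ∀ {x} → DoorFloor x → Star (Edge DoorFloor) x d₁
      to-door (inj₁ dx)  = walk-map inj₁ (d-connected dx d₁-in)
      to-door (inj₂ refl) = (v~d₁ , inj₁ d₁-in) ◅ ε

      door-c : ∀ {b} → DoorFloor b → C.Comp b
      door-c (inj₁ db)   = proj₁ (d-in db)
      door-c (inj₂ refl) = v-in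

      unshifted : (K : Kind) → (∀ {i x} → Kind.Hit K i x → x ~ s i) → Class.Placement K
      unshifted K hit-s = record
        { σ = s ; level-σ = id ; σ-level = s-level ; shift = id ; shift-< = id ; hit-σ = λ _ → hit-s
        ; V-≢σ = λ vx le e → V-≢ vx (trans e (cong s (trans (sym (trans (cong B.dist e) (proj₂ (s-level le)))) (proj₂ (J-level (V-J vx))))))
        ; V-~σ = λ vx → J-~s (V-J vx) (V-≢ vx)
        ; σ-step = proj₁ ∘ proj₂ ∘ s-next
        ; Floor = DoorFloor ; floor? = λ b → D.comp? b ⊎-dec (b ≟ᶠ v)
        ; connected = λ fa fb → to-door fa ◅◅ reverse-walk fb (to-door fb)
        ; D⊆Floor = inj₁ ; Floor⊆C = door-c
        ; σ-floor = λ lt f → level-far (s-level (<⇒≤ lt)) (c-level (door-c f)) (s≤s lt)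
        ; σ-bottom = v , inj₂ refl , a~v
        }
        where open Class K using (V-≢; V-J)

      upper : Kind
      upper = record
        { Hit    = λ i x → x ≢ s (suc i) × x ~ s i × ¬ x ~ s (suc i)
        ; Pass   = λ i x → x ≢ s (suc i) × ¬ x ~ s (suc i)
        ; hit?   = λ i x → ¬? (x ≟ᶠ s (suc i)) ×-dec ((x ~? s i) ×-dec ¬? (x ~? s (suc i)))
        ; pass?  = λ i x → ¬? (x ≟ᶠ s (suc i)) ×-dec ¬? (x ~? s (suc i))
        ; hit-≢  = proj₁
        ; pass-≢ = proj₁
        }

      -- After the shift `s (suc i)` acts as the spine parent, so this kind falls under the even
      -- case as well. The vertex `s i` is then two levels up and must be missed.
      lower : Kind
      lower = record
        { Hit    = λ i x → x ≢ s (suc i) × ¬ x ~ s i × x ~ s (suc i)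
        ; Pass   = λ i x → x ≢ s (suc i) × ¬ x ~ s i
        ; hit?   = λ i x → ¬? (x ≟ᶠ s (suc i)) ×-dec (¬? (x ~? s i) ×-dec (x ~? s (suc i)))
        ; pass?  = λ i x → ¬? (x ≟ᶠ s (suc i)) ×-dec ¬? (x ~? s i)
        ; hit-≢  = proj₁
        ; pass-≢ = proj₁
        }

      -- Restricting hits to levels of one parity keeps them out of consecutive levels, as `sparse`
      -- demands.
      both : Fin 2 → Kind
      both π = record
        { Hit    = λ i x → parity₂ (suc i) ≡ π × x ~ s i × x ~ s (suc i)
        ; Pass   = λ i x → x ≢ s (suc i) × ¬ x ~ s i × ¬ x ~ s (suc i)
        ; hit?   = λ i x → (parity₂ (suc i) ≟ᶠ π) ×-dec ((x ~? s i) ×-dec (x ~? s (suc i)))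
        ; pass?  = λ i x → ¬? (x ≟ᶠ s (suc i)) ×-dec (¬? (x ~? s i) ×-dec ¬? (x ~? s (suc i)))
        ; hit-≢  = λ (_ , _ , e) → ~⇒≢ e
        ; pass-≢ = proj₁
        }

      Caught : Kind → Fin n → Set
      Caught = Class.Caught

      col-upper : Col _~_ (Caught upper) Y
      col-upper = Class.col-caught-even upper (unshifted upper (proj₁ ∘ proj₂)) λ _ → avoid
        where
        avoid : ∀ {i x} → Class.V upper i x → ¬ x ~ s i
        avoid {suc i} (_ , inj₁ (_ , _ , ¬e))    = ¬e
        avoid {suc i} (_ , inj₂ ((_ , ¬e) , _)) = ¬e

      col-both : ∀ π → Col _~_ (Caught (both π)) Y
      col-both π = Class.col-caught-odd (both π) (unshifted (both π) (proj₁ ∘ proj₂)) both₁ both₂ sparse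
        where
        open Class (both π) using (V)

        both₁ : ∀ {i x} → V (suc i) x → x ~ s i → x ~ s (suc i)
        both₁ (_ , inj₁ (_ , _ , e)) _ = e
        both₁ (_ , inj₂ ((_ , ¬e , _) , _)) e = contradiction e ¬e

        both₂ : ∀ {i x} → V (suc i) x → x ~ s (suc i) → x ~ s i
        both₂ (_ , inj₁ (_ , e , _)) _ = e
        both₂ (_ , inj₂ ((_ , _ , ¬e) , _)) e = contradiction e ¬e

        sparse : ∀ {i x y} → V (suc i) x → x ~ s (suc i) → V i y → ¬ y ~ s i
        sparse {suc i} (_ , inj₂ ((_ , _ , ¬e) , _)) e _ _ = ¬e e
        sparse {suc i} (_ , inj₁ (p , _)) _ (_ , inj₁ (p′ , _)) _ = parity₂-suc (suc i) (trans p (sym p′))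
        sparse {suc i} (_ , inj₁ _) _ (_ , inj₂ ((_ , _ , ¬e) , _)) e = ¬e e

      module Lower where

        s⁺ : ℕ → Fin n
        s⁺ = extend m s v

        s⁺-≤ : ∀ {j} → j ≤ m → s⁺ j ≡ s j
        s⁺-≤ = extend-≤ m s v

        s⁺-last : s⁺ (suc m) ≡ v
        s⁺-last = extend-last m s v

        s⁺-level : ∀ {i} → i ≤ m → Level (suc i) (s⁺ (suc i))
        s⁺-level le = extend-all {P = Level} m s v s-level (c-level v-in) (s≤s le)

        s⁺-step : ∀ {i} → i < m → s⁺ (suc i) ~ s⁺ (suc (suc i))
        s⁺-step = extend-step {R = _~_} m s v (proj₁ ∘ proj₂ ∘ s-next) a~v

        open Class lower using (V; V-J; V-≢)

        avoid : ∀ {i x} → V (suc i) x → ¬ x ~ s i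
        avoid (_ , inj₁ (_ , ¬e , _))    = ¬e
        avoid (_ , inj₂ ((_ , ¬e) , _)) = ¬e

        V-≢σ : ∀ {i j x} → V i x → j ≤ m → x ≢ s⁺ (suc j)
        V-≢σ {i} {j} {x} vx le e = V-≢ vx (trans e (trans (cong s⁺ j≡i) (s⁺-≤ (proj₁ (V-J vx)))))
          where
          j≡i : suc j ≡ i
          j≡i = trans (sym (trans (cong B.dist e) (proj₂ (s⁺-level le)))) (proj₂ (J-level (V-J vx)))

        V-~σ : ∀ {i j x} → V i x → j ≤ m → x ~ s⁺ (suc j) → j ≡ i ⊎ suc j ≡ i
        V-~σ {i} {j} {x} vx le e = go (<-cmp j i)
          where
          not-two : suc (suc j) ≢ i
          not-two refl = avoid vx (subst (x ~_) (s⁺-≤ (≤-trans (n≤1+n _) (proj₁ (V-J vx)))) e)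

          go : Tri (j < i) (j ≡ i) (i < j) → j ≡ i ⊎ suc j ≡ i
          go (tri≈ _ j≡i _) = inj₁ j≡i
          go (tri> _ _ i<j) = contradiction e (proj₁ (level-far (J-level (V-J vx)) (s⁺-level le) (s≤s i<j)))
          go (tri< j<i _ _) = near (m≤n⇒m<n∨m≡n j<i)
            where
            near : suc j < i ⊎ suc j ≡ i → j ≡ i ⊎ suc j ≡ i
            near (inj₂ e′) = inj₂ e′
            near (inj₁ lt) = contradiction (≤-antisym lt (B.level-≤ (s⁺-level le) (J-level (V-J vx)) (~-sym e))) not-two

        even : ∀ {i x} → i < m → V i x → ¬ x ~ s⁺ (suc i)
        even {i} {x} lt vx e = V-≢ vx (proj₂ (proj₂ (s-next lt)) x (V-J vx) (subst (x ~_) (s⁺-≤ lt) e))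

        σ-far : ∀ {i b} → suc i ≤ m → D.Comp b → Far (s (suc i)) b
        σ-far lt db with m≤n⇒m<n∨m≡n lt
        ... | inj₁ lt′  = level-far (s-level lt) (d-level db) (s≤s lt′)
        ... | inj₂ refl = proj₂ (d-in db) , level-≢ (s-level lt) (d-level db) λ ()

        placement : Class.Placement lower
        placement = record
          { σ = λ i → s⁺ (suc i) ; level-σ = suc ; σ-level = s⁺-level ; shift = suc-injective ; shift-< = s≤s
          ; hit-σ = λ { {x = x} j (_ , _ , e) → subst (x ~_) (sym (s⁺-≤ (proj₁ j))) e }
          ; V-≢σ = V-≢σ ; V-~σ = V-~σ ; σ-step = s⁺-step
          ; Floor = D.Comp ; floor? = D.comp? ; connected = d-connected ; D⊆Floor = id ; Floor⊆C = proj₁ ∘ d-in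
          ; σ-floor = λ {i} {b} lt db → subst (λ u → Far u b) (sym (s⁺-≤ lt)) (σ-far lt db)
          ; σ-bottom = d₁ , d₁-in , subst (_~ d₁) (sym s⁺-last) v~d₁
          }

        col-lower : Col _~_ (Caught lower) Y
        col-lower = Class.col-caught-even lower placement even

      open Class using (V)

      -- A vertex that misses the spine inherits the kind of a parent. The recursion ends because
      -- level 0 consists of `s 0` alone.
      classify : ∀ i {x} → J i x → x ≢ s i →
                 V upper i x ⊎ V lower i x ⊎ V (both zero) i x ⊎ V (both (suc zero)) i x
      classify zero    j x≢s = contradiction (trans (B.level-zero (J-level j)) (sym s-zero)) x≢s
      classify (suc i) {x} j x≢s with x ~? s i | x ~? s (suc i)
      ... | yes e | no ¬e′ = inj₁ (j , inj₁ (x≢s , e , ¬e′))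
      ... | no ¬e | yes e′ = inj₂ (inj₁ (j , inj₁ (x≢s , ¬e , e′)))
      ... | yes e | yes e′ with zero-or-one (parity₂ (suc i))
      ...   | inj₁ eq = inj₂ (inj₂ (inj₁ (j , inj₁ (eq , e , e′))))
      ...   | inj₂ eq = inj₂ (inj₂ (inj₂ (j , inj₁ (eq , e , e′))))
      classify (suc i) {x} j x≢s | no ¬e | no ¬e′ with J-up j
      ... | y , jy , r with classify i jy (λ { refl → ¬e (~-sym r) })
      ...   | inj₁ c = inj₁ (j , inj₂ ((x≢s , ¬e′) , y , c , r))
      ...   | inj₂ (inj₁ c) = inj₂ (inj₁ (j , inj₂ ((x≢s , ¬e) , y , c , r)))
      ...   | inj₂ (inj₂ (inj₁ c)) = inj₂ (inj₂ (inj₁ (j , inj₂ ((x≢s , ¬e , ¬e′) , y , c , r))))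
      ...   | inj₂ (inj₂ (inj₂ c)) = inj₂ (inj₂ (inj₂ (j , inj₂ ((x≢s , ¬e , ¬e′) , y , c , r))))

      col-part : Col _~_ D.Comp (Y + (Y + (Y + Y)))
      col-part = col-⊆ split
        (col-∪ (Class.caught? upper) col-upper (col-∪ (Class.caught? lower) Lower.col-lower
          (col-∪ (Class.caught? (both zero)) (col-both zero) (col-both (suc zero)))))
        where
        split : ∀ {d} → D.Comp d → Caught upper d ⊎ Caught lower d ⊎ Caught (both zero) d ⊎ Caught (both (suc zero)) d
        split {d} dd with P₁.J-keeps-last (proj₁ (d-in dd)) (has-parent (d-level dd))
        ... | y , jy , e with classify m jy (λ { refl → proj₂ (d-in dd) e })
        ...   | inj₁ c = inj₁ (dd , y , c , e)
        ...   | inj₂ (inj₁ c) = inj₂ (inj₁ (dd , y , c , e))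
        ...   | inj₂ (inj₂ (inj₁ c)) = inj₂ (inj₂ (inj₁ (dd , y , c , e)))
        ...   | inj₂ (inj₂ (inj₂ c)) = inj₂ (inj₂ (inj₂ (dd , y , c , e)))

    col-component : Fin (Y + (Y + (Y + Y))) → Col _~_ C.Comp (N + (Y + (Y + (Y + Y))))
    col-component d = col-⊆ split (col-∪ nbr? (col-nbrs a nbr? proj₂) (col-by-comps _~?_ ~-sym X′? d Part.col-part))
      where
      nbr? : Decidable (λ x → C.Comp x × a ~ x)
      nbr? x = C.comp? x ×-dec (a ~? x)
      split : ∀ {x} → C.Comp x → (C.Comp x × a ~ x) ⊎ X′ x
      split {x} cx with a ~? x
      ... | yes e = inj₁ (cx , e)
      ... | no ¬e = inj₂ (cx , ¬e)

  private
    4Y = Y + (Y + (Y + Y))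

  col-growth : 0 < N → Col _~_ (λ _ → ⊤) (2 * (N + 4Y))
  col-growth N>0 = col-by-levels _~?_ ~-sym (λ _ → yes tt) (element (≤-trans total (m≤m+n (N + 4Y) _))) level
    where
    total : 0 < N + 4Y
    total = ≤-trans N>0 (m≤m+n N 4Y)

    Y>0 : 0 < Y
    Y>0 = *-mono-≤ (*-mono-≤ (m^n>0 2 w) inner) inner
      where
      inner : 0 < 2 ^ w * N
      inner = *-mono-≤ (m^n>0 2 w) N>0

    module B = BFS _~_ _~?_ ~-sym (λ _ → ⊤) (λ _ → yes tt)

    from-root : ∀ {z x} → B.Level z 1 x → z ~ x
    from-root {z} l with B.level-parent z l
    ... | y , ly , e with B.level-zero z ly
    ...   | refl = e

    level : ∀ z → ⊤ → ∀ i → Col _~_ (B.Level z i) (N + 4Y)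
    level z _ zero = edgeless (element total) λ lx ly →
      λ e → ~⇒≢ e (trans (B.level-zero z lx) (sym (B.level-zero z ly)))
    level z _ (suc zero) = col-mono (m≤m+n N 4Y) (col-nbrs z (B.level? z 1) from-root)
    level z _ (suc (suc i)) = col-by-comps _~?_ ~-sym (B.level? z (suc (suc i))) (element total)
      λ c lc → Below.col-component z i c lc (element (≤-trans Y>0 (m≤m+n Y _)))

-- Holes, cliques and the bipartite case

2∣⇒even : ∀ {A : Set} (xs : List A) → 2 ∣ length xs → odd xs ≡ false
2∣⇒even xs (divides q e) = go q xs e
  where
  go : ∀ q (xs : List _) → length xs ≡ q * 2 → odd xs ≡ false
  go zero    []           _ = refl
  go (suc q) (_ ∷ _ ∷ xs) e = trans (Bool.not-involutive _) (go q xs (suc-injective (suc-injective e)))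

module Conversion {n} (G : Graph n) where
  open Paths G

  vertices : Fin n → List (Fin n) → Fin n → List (Fin n)
  vertices y []       z = y ∷ z ∷ []
  vertices y (p ∷ ps) z = y ∷ vertices p ps z

  odd-vertices : ∀ {y} ps {z} → odd (vertices y ps z) ≡ odd ps
  odd-vertices []       = refl
  odd-vertices (_ ∷ ps) = cong not (odd-vertices ps)

  Succ : ∀ {k} → Fin k → Fin k → Set
  Succ i j = toℕ j ≡ suc (toℕ i)

  all-vertices : ∀ {Q : Fin n → Set} {y z} ps → Q y → All Q ps → Q z → All Q (vertices y ps z)
  all-vertices []       qy _        qz = qy ∷ qz ∷ []
  all-vertices (p ∷ ps) qy (q ∷ qs) qz = qy ∷ all-vertices ps q qs qz

  at : ∀ {Q : Fin n → Set} {y z} ps → Q y → All Q ps → Q z → ∀ i → Q (lookup (vertices y ps z) i)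
  at {y = y} {z} ps qy qs qz i = All.lookup (all-vertices ps qy qs qz) (∈-lookup {xs = vertices y ps z} i)

  Meets : Fin n → Fin n → Set → Set
  Meets x u P = (x ~ u → P) × (P → x ~ u) × x ≢ u

  meets : ∀ {x u P} → x ~ u → P → Meets x u P
  meets e p = (λ _ → p) , (λ _ → e) , ~⇒≢ e

  avoids : ∀ {x u P} → Far x u → ¬ P → Meets x u P
  avoids (¬e , x≢u) ¬p = (λ e → contradiction e ¬e) , (λ p → contradiction p ¬p) , x≢u

  head-only : ∀ {x y z} ps → x ~ y → All (Far x) ps → Far x z →
              ∀ i → Meets x (lookup (vertices y ps z) i) (toℕ i ≡ 0)
  head-only []       e _        f zero       = meets e refl
  head-only []       e _        f (suc zero) = avoids f λ ()
  head-only (p ∷ ps) e _        f zero       = meets e refl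
  head-only (p ∷ ps) e (g ∷ gs) f (suc i)    = avoids (at ps g gs f i) λ ()

  last-only : ∀ {x y z} ps → Far x y → All (Far x) ps → x ~ z →
              ∀ i → Meets x (lookup (vertices y ps z) i) (suc (toℕ i) ≡ length (vertices y ps z))
  last-only []       f _ e zero       = avoids f λ ()
  last-only []       f _ e (suc zero) = meets e refl
  last-only (p ∷ [])      f _ e zero  = avoids f λ ()
  last-only (p ∷ _ ∷ _)   f _ e zero  = avoids f λ ()
  last-only (p ∷ ps) f (g ∷ gs) e (suc i) with last-only ps g gs e i
  ... | a , b , c = cong suc ∘ a , b ∘ suc-injective , c

  both-ends : ∀ {x y z} ps → x ~ y → All (Far x) ps → x ~ z →
              ∀ i → Meets x (lookup (vertices y ps z) i) (toℕ i ≡ 0 ⊎ suc (toℕ i) ≡ length (vertices y ps z))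
  both-ends []       e _        e′ zero       = meets e (inj₁ refl)
  both-ends []       e _        e′ (suc zero) = meets e′ (inj₂ refl)
  both-ends (p ∷ ps) e _        e′ zero       = meets e (inj₁ refl)
  both-ends (p ∷ ps) e (g ∷ gs) e′ (suc i) with last-only ps g gs e′ i
  ... | a , b , c = inj₂ ∘ cong suc ∘ a , (λ { (inj₂ q) → b (suc-injective q) }) , c

  Linear : (L : List (Fin n)) → Set
  Linear L = ∀ i j → (lookup L i ~ lookup L j → Succ i j ⊎ Succ j i) × (Succ i j → lookup L i ~ lookup L j) ×
             (lookup L i ≡ lookup L j → i ≡ j)

  linear-∷ : ∀ {x L} → (∀ i → Meets x (lookup L i) (toℕ i ≡ 0)) → Linear L → Linear (x ∷ L)
  linear-∷ h l zero    zero    = (λ e → contradiction e ~-irr) , (λ ()) , λ _ → refl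
  linear-∷ h l zero    (suc j) with h j
  ... | a , b , c = inj₁ ∘ cong suc ∘ a , b ∘ suc-injective , λ e → contradiction e c
  linear-∷ h l (suc i) zero    with h i
  ... | a , b , c = inj₂ ∘ cong suc ∘ a ∘ ~-sym , (λ ()) , λ e → contradiction (sym e) c
  linear-∷ h l (suc i) (suc j) with l i j
  ... | a , b , c = (λ e → lift (a e)) , b ∘ suc-injective , cong suc ∘ c
    where
    lift : Succ i j ⊎ Succ j i → Succ (suc i) (suc j) ⊎ Succ (suc j) (suc i)
    lift (inj₁ e) = inj₁ (cong suc e)
    lift (inj₂ e) = inj₂ (cong suc e)

  path-linear : ∀ {y z} ps → Path y ps z → Linear (vertices y ps z)
  path-linear []       e = linear-∷ (λ { zero → meets e refl }) λ { zero zero → (λ e → contradiction e ~-irr) , (λ ()) , λ _ → refl }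
  path-linear (p ∷ ps) (e , fs , f , π) = linear-∷ (head-only ps e fs f) (path-linear ps π)

  module Closed {x y z} (p : Fin n) (ps : List (Fin n)) (π : Path y (p ∷ ps) z) (x~y : x ~ y) (x~z : x ~ z)
    (fs : All (Far x) (p ∷ ps)) where

    L : List (Fin n)
    L = vertices y (p ∷ ps) z

    long : 4 ≤ suc (length L)
    long = s≤s (s≤s (two ps))
      where
      two : ∀ {q} ps → 2 ≤ length (vertices q ps z)
      two []       = s≤s (s≤s z≤n)
      two (q ∷ ps) = ≤-trans (two ps) (n≤1+n _)

    ends = both-ends (p ∷ ps) x~y fs x~z
    lin  = path-linear (p ∷ ps) π

    from : ∀ i j → lookup (x ∷ L) i ~ lookup (x ∷ L) j → Next i j ⊎ Next j i
    from zero zero e = contradiction e ~-irr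
    from zero (suc j) e with proj₁ (ends j) e
    ... | inj₁ q = inj₁ (inj₁ (cong suc q))
    ... | inj₂ q = inj₂ (inj₂ (cong suc q , refl))
    from (suc i) zero e with proj₁ (ends i) (~-sym e)
    ... | inj₁ q = inj₂ (inj₁ (cong suc q))
    ... | inj₂ q = inj₁ (inj₂ (cong suc q , refl))
    from (suc i) (suc j) e with proj₁ (lin i j) e
    ... | inj₁ q = inj₁ (inj₁ (cong suc q))
    ... | inj₂ q = inj₂ (inj₁ (cong suc q))

    next : ∀ i j → Next i j → lookup (x ∷ L) i ~ lookup (x ∷ L) j
    next zero    (suc j) (inj₁ q)       = proj₁ (proj₂ (ends j)) (inj₁ (suc-injective q))
    next (suc i) (suc j) (inj₁ q)       = proj₁ (proj₂ (lin i j)) (suc-injective q)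
    next (suc i) zero    (inj₂ (q , _)) = ~-sym (proj₁ (proj₂ (ends i)) (inj₂ (suc-injective q)))
    next zero    zero    (inj₂ (() , _))

    to : ∀ i j → Next i j ⊎ Next j i → lookup (x ∷ L) i ~ lookup (x ∷ L) j
    to i j (inj₁ q) = next i j q
    to i j (inj₂ q) = ~-sym (next j i q)

    injective : ∀ i j → lookup (x ∷ L) i ≡ lookup (x ∷ L) j → i ≡ j
    injective zero    zero    e = refl
    injective zero    (suc j) e = contradiction e (proj₂ (proj₂ (ends j)))
    injective (suc i) zero    e = contradiction (sym e) (proj₂ (proj₂ (ends i)))
    injective (suc i) (suc j) e = cong suc (proj₂ (proj₂ (lin i j)) e)

    hole : Hole G
    hole = record
      { length   = suc (length L)
      ; length≥4 = long
      ; copy     = record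
        { embed     = lookup (x ∷ L)
        ; injective = λ {i} {j} → injective i j
        ; induced   = λ i j → mk⇔ (to i j) (from i j)
        }
      }

  odd-hole-free : ¬ OddHole G → OddHoleFree
  odd-hole-free free []       π e e′ fs o ne = ne refl
  odd-hole-free free {x} {y} (p ∷ ps) π e e′ fs o _ = free (hole , λ d → true≢false′ (2∣⇒even (x ∷ L) d)
      (cong not (trans (odd-vertices {y} (p ∷ ps)) o)))
    where
    open Closed p ps π e e′ fs
    true≢false′ : ∀ {b} → b ≡ false → ¬ b ≡ true
    true≢false′ refl ()

  ∣⁅x⁆∪p∣ : ∀ {k} (x : Fin k) (p : Subset k) → x ∉ p → ∣ ⁅ x ⁆ ∪ p ∣ ≡ suc ∣ p ∣
  ∣⁅x⁆∪p∣ zero    (inside  ∷ p) x∉p = contradiction here x∉p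
  ∣⁅x⁆∪p∣ zero    (outside ∷ p) x∉p = cong (λ q → suc ∣ q ∣) (∪-identityˡ p)
  ∣⁅x⁆∪p∣ (suc x) (inside  ∷ p) x∉p = cong suc (∣⁅x⁆∪p∣ x p (x∉p ∘ there))
  ∣⁅x⁆∪p∣ (suc x) (outside ∷ p) x∉p = ∣⁅x⁆∪p∣ x p (x∉p ∘ there)

  clique-subset : ∀ K → AllPairs _~_ K → ∃[ S ] (∣ S ∣ ≡ length K × IsClique G S × (∀ {Q : Fin n → Set} → All Q K → ∀ {u} → u ∈ S → Q u))
  clique-subset [] _ = ∅ , ∣⊥∣≡0 n , (λ u v u∈ → contradiction u∈ ∉⊥) , λ _ u∈ → contradiction u∈ ∉⊥
  clique-subset (x ∷ K) (es ∷ ps) with clique-subset K ps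
  ... | S , card , clq , all =
    ⁅ x ⁆ ∪ S , trans (∣⁅x⁆∪p∣ x S (λ x∈ → ~-irr (all es x∈))) (cong suc card) ,
    (λ u v u∈ v∈ → clique (member u∈) (member v∈)) , λ { (q ∷ qs) u∈ → holds q qs (member u∈) }
    where
    member : ∀ {u} → u ∈ ⁅ x ⁆ ∪ S → u ≡ x ⊎ u ∈ S
    member u∈ with x∈p∪q⁻ ⁅ x ⁆ S u∈
    ... | inj₁ e = inj₁ (x∈⁅y⁆⇒x≡y x e)
    ... | inj₂ r = inj₂ r
    clique : ∀ {u v} → u ≡ x ⊎ u ∈ S → v ≡ x ⊎ v ∈ S → u ≢ v → u ~ v
    clique (inj₁ refl) (inj₁ refl) u≢v = contradiction refl u≢v
    clique (inj₁ refl) (inj₂ v∈)   _   = all es v∈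
    clique (inj₂ u∈)   (inj₁ refl) _   = ~-sym (all es u∈)
    clique (inj₂ u∈)   (inj₂ v∈)   u≢v = clq _ _ u∈ v∈ u≢v
    holds : ∀ {Q : Fin n → Set} → Q x → All Q K → ∀ {u} → u ≡ x ⊎ u ∈ S → Q u
    holds q qs (inj₁ refl) = q
    holds q qs (inj₂ u∈)   = all qs u∈

  clique-bound : CliqueBound _~_ (λ _ → ⊤) (ω G)
  clique-bound K ps _ with clique-subset K ps
  ... | S , card , clq , _ = proj₂ (ω-isCliqueNumber G) (length K) (S , clq , card)

-- Clique number two

module Bipartite {n} (G : Graph n) (ohf : Paths.OddHoleFree G) (cb : CliqueBound (Adj G) (λ _ → ⊤) 2) where
  open Paths G

  no-triangle : ∀ {x y p} → p ~ x → x ~ y → ¬ p ~ y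
  no-triangle e e′ e″ with cb (_ ∷ _ ∷ _ ∷ []) ((e ∷ e″ ∷ []) ∷ (e′ ∷ []) ∷ [] ∷ []) (tt ∷ tt ∷ tt ∷ [])
  ... | s≤s (s≤s ())

  module _ (z : Fin n) where
    open BFS _~_ _~?_ ~-sym (λ _ → ⊤) (λ _ → yes tt) z

    levelling : Levelling G
    levelling = record
      { Λ = Level ; Λ? = level?
      ; disjoint = λ l l′ → trans (sym (proj₂ l)) (proj₂ l′)
      ; distant = λ l l′ lt e → <-irrefl refl (≤-trans lt (level-≤ l l′ e))
      ; apex = λ l l′ → trans (level-zero l) (sym (level-zero l′))
      ; up = level-parent
      }

    open Links levelling using (Link; share; cross; climb; link; link-path; parent; parent-ok; below-far; τ; level-≢)

    -- Mutual induction on the level: stability of the levels above leaves no `cross`, so links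
    -- there are even; adjacent vertices of one level then have distinct parents, whose even link
    -- closes to an odd hole.
    level-stable    : ∀ i {x y} → Level i x → Level i y → ¬ x ~ y
    link-even : ∀ i {x y π} → Link i x y π → π ≡ false

    link-even (suc i) (share _ _ _ _ _ _)            = refl
    link-even (suc i) (cross _ _ _ l l′ _ _ _ _ e)   = contradiction e (level-stable i l l′)
    link-even (suc i) (climb _ _ _ _ _ _ _ _ _ link) = link-even i link

    level-stable zero lx ly e = ~⇒≢ e (trans (level-zero lx) (sym (level-zero ly)))
    level-stable (suc i) {x} {y} lx ly e with parent-ok lx | parent-ok ly
    ... | lp , px | lp′ , py with link i lp lp′ (level-stable i lp lp′ , λ eq → no-triangle px e (subst (_~ y) (sym eq) py))
    ...   | l with link-path l | link-even i l
    ...     | ps , ρ , o , b | even = ohf (ps ∷ʳ parent i y)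
      (snoc ps ρ py (All.map (λ u → Far-sym (below-far u ly)) b)
        (Far-sym (no-triangle px e , level-≢ lp ly)))
      (~-sym px) e
      (++⁺ (All.map (λ u → Far-sym (below-far u lx)) b) ((no-triangle py (~-sym e) ∘ ~-sym , level-≢ lp′ lx ∘ sym) ∷ []))
      (trans (odd-∷ʳ ps) (cong not (trans o (cong not even)))) (nonempty ps)
      where
      nonempty : ∀ ps → ps ∷ʳ parent i y ≢ []
      nonempty []       ()
      nonempty (_ ∷ _) ()

  col-2 : Col _~_ (λ _ → ⊤) 2
  col-2 = col-by-levels _~?_ ~-sym {N = 1} (λ _ → yes tt) zero
    λ z _ i → (λ _ → zero) , λ lx ly e → contradiction e (level-stable z i lx ly)

-- Induction on the clique number

-- The bound for clique number suc w in terms of the bound N for clique number w.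
growth : ℕ → ℕ → ℕ
growth w N = 2 * (N + (Y + (Y + (Y + Y))))
  where
  Y = (2 ^ w * (2 ^ w * N)) * (2 ^ w * N)

-- Only edges are removed: vertices outside `X` stay as isolated ones, so the vertex type does not
-- change.
restrict : ∀ {n} (G : Graph n) {X : Fin n → Set} → Decidable X → Graph n
restrict G {X} X? = record
  { Adj      = λ u v → Adj G u v × X u × X v
  ; adj?     = λ u v → adj? G u v ×-dec (X? u ×-dec X? v)
  ; symAdj   = λ (e , x , y) → symAdj G e , y , x
  ; loopless = λ eq (e , _) → loopless G eq e
  }

module _ {n} (G : Graph n) {X : Fin n → Set} (X? : Decidable X) where
  private
    module P = Paths G
    module R = Paths (restrict G X?)

  restrict-path : ∀ {x y} ps → R.Path x ps y → X x × X y × All X ps × P.Path x ps y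
  restrict-path []       (e , xx , xy) = xx , xy , [] , e
  restrict-path (p ∷ ps) ((e , xx , xp) , fs , f , π) with restrict-path ps π
  ... | _ , xy , xs , ρ = xx , xy , xp ∷ xs , e , far xs fs , ((λ e → proj₁ f (e , xx , xy)) , proj₂ f) , ρ
    where
    far : ∀ {qs} → All X qs → All (R.Far _) qs → All (P.Far _) qs
    far [] [] = []
    far (x ∷ xs) ((¬e , ne) ∷ fs) = ((λ e → ¬e (e , xx , x)) , ne) ∷ far xs fs

  restrict-odd-hole-free : P.OddHoleFree → R.OddHoleFree
  restrict-odd-hole-free ohf {x} l π (e , xx , _) (e′ , _) fs o ne with restrict-path l π
  ... | _ , _ , xs , ρ = ohf l ρ e e′ (far xs fs) o ne
    where
    far : ∀ {qs} → All X qs → All (R.Far x) qs → All (P.Far x) qs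
    far [] [] = []
    far (y ∷ xs) ((¬e , ne) ∷ fs) = ((λ e → ¬e (e , xx , y)) , ne) ∷ far xs fs

  -- An isolated vertex outside `X` is a clique of size one, whence `suc w`; larger cliques lie in
  -- `X`.
  restrict-cliques : ∀ {w} → CliqueBound (Adj G) X (suc w) → CliqueBound (Adj (restrict G X?)) (λ _ → ⊤) (suc w)
  restrict-cliques cb []          _  _ = z≤n
  restrict-cliques cb (x ∷ [])    _  _ = s≤s z≤n
  restrict-cliques cb (x ∷ y ∷ K) ps@(es@((_ , xx , _) ∷ _) ∷ _) _ =
    cb (x ∷ y ∷ K) (AllPairs.map proj₁ ps) (xx ∷ All.map (proj₂ ∘ proj₂) es)

-- The separate value at 2 matters for the constant: the recursion would give `growth 1 1`, which is
-- 66, and 128 · 64 · 66 exceeds 2^16.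
bound : ℕ → ℕ
bound zero                = 1
bound (suc zero)          = 1
bound (suc (suc zero))    = 2
bound (suc w@(suc (suc _))) = growth w (bound w)

bound>0 : ∀ w → 0 < bound w
bound>0 zero                = s≤s z≤n
bound>0 (suc zero)          = s≤s z≤n
bound>0 (suc (suc zero))    = s≤s z≤n
bound>0 (suc w@(suc (suc _))) = ≤-trans (bound>0 w) (≤-trans (m≤m+n (bound w) _) (m≤m+n _ _))

ColourableBy : ℕ → ℕ → Set₁
ColourableBy w N = ∀ {n} (G : Graph n) → Paths.OddHoleFree G → CliqueBound (Adj G) (λ _ → ⊤) w → Col (Adj G) (λ _ → ⊤) N

col-step : ∀ {w N} → 0 < N → ColourableBy (suc w) N → ColourableBy (suc (suc w)) (growth (suc w) N)
col-step {w} {N} N>0 ih G ohf cb = LevelBound.col-growth G ohf (suc w) N small cb N>0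
  where
  small : ∀ {X} → Decidable X → CliqueBound (Adj G) X (suc w) → Col (Adj G) X N
  small X? cb with ih (restrict G X?) (restrict-odd-hole-free G X? ohf) (restrict-cliques G X? cb)
  ... | c , p = c , λ x y e → p tt tt (e , x , y)

col-bound : ∀ w → ColourableBy w (bound w)
col-bound zero G ohf cb = (λ _ → zero) , λ {u} _ _ _ _ → contradiction (cb (u ∷ []) ([] ∷ []) (tt ∷ [])) λ ()
col-bound (suc zero) G ohf cb = (λ _ → zero) , λ {u} {v} _ _ e _ →
  contradiction (cb (u ∷ v ∷ []) ((e ∷ []) ∷ [] ∷ []) (tt ∷ tt ∷ [])) λ { (s≤s ()) }
col-bound (suc (suc zero)) G ohf cb = Bipartite.col-2 G ohf cb
col-bound (suc w@(suc (suc _))) = col-step (bound>0 w) (col-bound w)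

-- Arithmetic of the bound

cube : ℕ → ℕ
cube w = 2 ^ w * 2 ^ w * 2 ^ w

cube>0 : ∀ w → 0 < cube w
cube>0 w = *-mono-≤ (*-mono-≤ (m^n>0 2 w) (m^n>0 2 w)) (m^n>0 2 w)

growth-≤ : ∀ w N → 0 < N → growth w N ≤ 16 * (cube w * (N * N))
growth-≤ w N N>0 = begin
  growth w N                          ≡⟨ expand (2 ^ w) N ⟩
  2 * (N + 4 * (cube w * (N * N)))    ≤⟨ *-monoʳ-≤ 2 (+-monoˡ-≤ _ N≤) ⟩
  -- The factor 10 is rounded up to 16 because 128 · 8 · 16 = 128², the 8 coming from
  -- `cube (suc w)`; this makes the later product a perfect square.
  2 * (C + 4 * C)                     ≤⟨ m≤m+n _ (6 * C) ⟩
  2 * (C + 4 * C) + 6 * C             ≡⟨ collect C ⟩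
  16 * C                              ∎
  where
  open ≤-Reasoning
  C = cube w * (N * N)

  N≤ : N ≤ C
  N≤ = subst (_≤ C) (+-identityʳ N) (*-mono-≤ (cube>0 w) (m≤m*n N N {{>-nonZero N>0}}))

  expand : ∀ a N → 2 * (N + ((a * (a * N)) * (a * N) + ((a * (a * N)) * (a * N) +
                    ((a * (a * N)) * (a * N) + (a * (a * N)) * (a * N))))) ≡
                   2 * (N + 4 * (a * a * a * (N * N)))
  expand = solve-∀

  collect : ∀ C → 2 * (C + 4 * C) + 6 * C ≡ 16 * C
  collect = solve-∀

-- The factor 128 · 8 ^ w makes the estimate self-reproducing: it is squared when w increases by one.
scaled-bound : ∀ k → 128 * cube (2 + k) * bound (2 + k) ≤ 2 ^ (2 ^ (2 + k + 2))
-- Here 16384 = 128 · 64 · 2, and 49152 is what remains up to 2^16.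
scaled-bound zero    = m≤m+n 16384 49152
scaled-bound (suc k) = begin
  128 * cube (3 + k) * growth w N              ≤⟨ *-monoʳ-≤ (128 * cube (3 + k)) (growth-≤ w N (bound>0 w)) ⟩
  128 * cube (3 + k) * (16 * (cube w * (N * N)))  ≡⟨ square (2 ^ w) N ⟩
  S * S                                        ≤⟨ *-mono-≤ (scaled-bound k) (scaled-bound k) ⟩
  2 ^ T * 2 ^ T                                ≡⟨ sym (^-distribˡ-+-* 2 T T) ⟩
  2 ^ (T + T)                                  ≡⟨ cong (λ m → 2 ^ (T + m)) (sym (+-identityʳ T)) ⟩
  2 ^ (2 ^ (3 + k + 2))                        ∎
  where
  open ≤-Reasoning
  w = 2 + k
  N = bound w
  S = 128 * cube w * N
  T = 2 ^ (w + 2)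

  square : ∀ a N → 128 * ((2 * a) * (2 * a) * (2 * a)) * (16 * (a * a * a * (N * N))) ≡
                   (128 * (a * a * a) * N) * (128 * (a * a * a) * N)
  square = solve-∀

bound-≤ : ∀ w → bound w ≤ 2 ^ (2 ^ (w + 2))
bound-≤ zero          = s≤s z≤n
bound-≤ (suc zero)    = s≤s z≤n
bound-≤ (suc (suc k)) = ≤-trans
  (m≤n*m (bound (2 + k)) (128 * cube (2 + k)) {{>-nonZero (*-mono-≤ {1} {128} (s≤s z≤n) (cube>0 (2 + k)))}})
  (scaled-bound k)

mainTheorem1 : ∀ (n : ℕ) (G : Graph n) → ¬ OddHole G → χ G ≤ 2 ^ (2 ^ (ω G + 2))
mainTheorem1 n G free with col-bound (ω G) G (Conversion.odd-hole-free G free) (Conversion.clique-bound G)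
... | c , proper = ≤-trans (proj₂ (χ-isChromaticNumber G) (bound (ω G)) (c , λ u v → proper tt tt)) (bound-≤ (ω G))
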